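{- Let $\theta,\eta$ be irrational real numbers such that $\varpi_\psi(\theta,\eta)>1$. Then $$\min(\omega(\theta),\omega(\eta))\ \ge\ \varpi_\psi(\theta,\eta)^2.$$
   Context: $\|x\|$ denotes the distance from the real number $x$ to the nearest integer, and $\mathbb{Z}_+$ is the set of positive integers. For an irrational real number $\theta$ and real $t\ge1$ define $$\psi_\theta(t)=\min_{q\in\mathbb{Z}_+:\,q\le t}\|q\theta\|,$$ and the ordinary Diophantine exponent $$\omega(\theta)=\sup\{\gamma\in\mathbb{R}:\ \liminf_{t\to\infty}t^{\gamma}\psi_\theta(t)<\infty\}\in[1,+\infty].$$ For two irrational real numbers $\theta,\eta$ define $\psi_{\theta,\eta}(t)=\min(\psi_\theta(t),\psi_\eta(t))$ and $$\varpi_\psi(\theta,\eta)=\sup\{\gamma\in\mathbb{R}:\ \limsup_{t\to\infty}t^{\gamma}\psi_{\theta,\eta}(t)<\infty\}\in[1,+\infty].$$ Convention: $(+\infty)^2=+\infty$. -}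

module Defs where

open import Level using (0ℓ)
open import Algebra.Bundles using (CommutativeRing)
open import Axiom.ExcludedMiddle using (ExcludedMiddle)
open import Data.Integer.Base as ℤ using (ℤ; +_; -[1+_]; -≤-; -≤+; +≤+)
import Data.Integer.Properties as ℤ
open import Data.Nat.Base as ℕ using (ℕ; zero; suc; z≤n; s≤s)
import Data.Nat.Properties as ℕ
open import Data.Product.Base using (Σ; Σ-syntax; ∃; ∃-syntax; _×_; _,_; proj₁; proj₂)
open import Data.Sum.Base using (_⊎_; inj₁; inj₂; [_,_]′)
open import Function.Base using (const)
open import Relation.Binary.Bundles using (TotalOrder)
open import Relation.Binary.Core using (Rel)
open import Relation.Binary.PropositionalEquality.Core as ≡ using (_≡_)
open import Relation.Binary.Structures using (IsTotalOrder)
open import Relation.Nullary.Construct.Add.Extrema using (_±; ⊥±; [_]; ⊤±)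
open import Relation.Nullary.Decidable.Core using (yes; no)
open import Relation.Nullary.Negation.Core using (¬_; contradiction)
open import Relation.Unary using (Pred)
import Algebra.Properties.AbelianGroup
import Algebra.Properties.Ring
import Algebra.Properties.Semiring.Exp
import Algebra.Properties.Semiring.Mult
import Relation.Binary.Construct.Add.Extrema.Equality
import Relation.Binary.Construct.Add.Extrema.NonStrict
import Relation.Binary.Construct.Add.Supremum.NonStrict as Supremum≤
import Relation.Binary.Properties.TotalOrder
import Relation.Binary.Reasoning.Setoid

module MinMax {a ℓ₁ ℓ₂} (T : TotalOrder a ℓ₁ ℓ₂) where
  open TotalOrder T

  _⊓_ : Carrier → Carrier → Carrier
  x ⊓ y = [ const x , const y ]′ (total x y)

  _⊔_ : Carrier → Carrier → Carrier
  x ⊔ y = [ const y , const x ]′ (total x y)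

module _ {a ℓ₁ ℓ₂} (T : TotalOrder a ℓ₁ ℓ₂) where
  open TotalOrder T

  IsUpperBound : Pred Carrier 0ℓ → Carrier → Set _
  IsUpperBound S u = ∀ x → S x → x ≤ u

  IsLowerBound : Pred Carrier 0ℓ → Carrier → Set _
  IsLowerBound S l = ∀ x → S x → l ≤ x

  IsSupremum : Pred Carrier 0ℓ → Carrier → Set _
  IsSupremum S s = IsUpperBound S s × (∀ u → IsUpperBound S u → s ≤ u)

  IsInfimum : Pred Carrier 0ℓ → Carrier → Set _
  IsInfimum S i = IsLowerBound S i × (∀ l → IsLowerBound S l → l ≤ i)

-- The real numbers are any model of the (categorical) axioms of a
-- Dedekind-complete ordered field.

record CompleteOrderedField : Set₁ where
  field
    commutativeRing : CommutativeRing 0ℓ 0ℓ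

  open CommutativeRing commutativeRing public

  infix 4 _≤_
  field
    _≤_          : Rel Carrier 0ℓ
    isTotalOrder : IsTotalOrder _≈_ _≤_

  totalOrder : TotalOrder 0ℓ 0ℓ 0ℓ
  totalOrder = record { isTotalOrder = isTotalOrder }

  field
    0≉1      : ¬ (0# ≈ 1#)
    inverse  : ∀ x → ¬ (x ≈ 0#) → ∃[ y ] x * y ≈ 1#
    +-monoˡ  : ∀ {x y} z → x ≤ y → x + z ≤ y + z
    *-nonneg : ∀ {x y} → 0# ≤ x → 0# ≤ y → 0# ≤ x * y
    complete : (S : Pred Carrier 0ℓ) → ∃ S → ∃ (IsUpperBound totalOrder S) →
               ∃ (IsSupremum totalOrder S)

-- The mathematics is classical, so excluded middle is a parameter.

module Diophantine (em : ExcludedMiddle 0ℓ) (ℝ-field : CompleteOrderedField) where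

  open CompleteOrderedField ℝ-field public renaming (Carrier to ℝ)
  open TotalOrder totalOrder public
    using (antisym; total) renaming (refl to ≤-refl; trans to ≤-trans; reflexive to ≤-reflexive)
  open Relation.Binary.Properties.TotalOrder totalOrder public using (_<_)
  open MinMax totalOrder public using (_⊓_; _⊔_)
  open Algebra.Properties.Semiring.Exp semiring public using (_^_)
  open Algebra.Properties.Semiring.Mult semiring public using () renaming (_×_ to _·_)

  private
    module Exp = Algebra.Properties.Semiring.Exp semiring
    module Mult = Algebra.Properties.Semiring.Mult semiring
    module G = Algebra.Properties.AbelianGroup +-abelianGroup
    module Rng = Algebra.Properties.Ring ring
    module ≈R = Relation.Binary.Reasoning.Setoid setoid

  fromℕ : ℕ → ℝ
  fromℕ n = n · 1#

  fromℤ : ℤ → ℝ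
  fromℤ (+ n)    = fromℕ n
  fromℤ -[1+ n ] = - fromℕ (suc n)

  ∣_∣ : ℝ → ℝ
  ∣ x ∣ = x ⊔ (- x)

  ℝ≥1 : Set
  ℝ≥1 = Σ[ t ∈ ℝ ] 1# ≤ t

  module FieldLemmas where
    resp : ∀ {x x′ y y′} → x ≈ x′ → y ≈ y′ → x ≤ y → x′ ≤ y′
    resp x≈ y≈ p = ≤-trans (≤-reflexive (sym x≈)) (≤-trans p (≤-reflexive y≈))

    +-mono : ∀ {x y u v} → x ≤ y → u ≤ v → x + u ≤ y + v
    +-mono {x} {y} {u} {v} p q =
      ≤-trans (+-monoˡ u p) (resp (+-comm u y) (+-comm v y) (+-monoˡ y q))

    x+y-y : ∀ x y → x + y + - y ≈ x
    x+y-y x y = trans (+-assoc x y (- y)) (trans (+-congˡ (-‿inverseʳ y)) (+-identityʳ x))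

    x-y+y : ∀ x y → x + - y + y ≈ x
    x-y+y x y = trans (+-assoc x (- y) y) (trans (+-congˡ (-‿inverseˡ y)) (+-identityʳ x))

    +-cancel : ∀ {x y} z → x + z ≤ y + z → x ≤ y
    +-cancel {x} {y} z p = resp (x+y-y x z) (x+y-y y z) (+-monoˡ (- z) p)

    0≤y-x : ∀ {x y} → x ≤ y → 0# ≤ y + - x
    0≤y-x {x} {y} p = resp (-‿inverseʳ x) refl (+-monoˡ (- x) p)

    0≤y-x⇒x≤y : ∀ {x y} → 0# ≤ y + - x → x ≤ y
    0≤y-x⇒x≤y {x} {y} p = resp (+-identityˡ x) (x-y+y y x) (+-monoˡ x p)

    neg-mono : ∀ {x y} → x ≤ y → - y ≤ - x
    neg-mono {x} {y} p = +-cancel x (+-cancel y (resp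
      (sym (trans (+-congʳ (+-comm (- y) x)) (x-y+y x y)))
      (sym (trans (+-congʳ (-‿inverseˡ x)) (+-identityˡ y))) p))

    0≤1 : 0# ≤ 1#
    0≤1 with total 0# 1#
    ... | inj₁ p = p
    ... | inj₂ p = resp refl -1*-1≈1 (*-nonneg 0≤-1 0≤-1)
      where
      0≤-1 : 0# ≤ - 1#
      0≤-1 = resp G.ε⁻¹≈ε refl (neg-mono p)
      -1*-1≈1 : - 1# * - 1# ≈ 1#
      -1*-1≈1 = trans (Rng.-1*x≈-x (- 1#)) (G.⁻¹-involutive 1#)

    1≰0 : ¬ (1# ≤ 0#)
    1≰0 p = 0≉1 (antisym 0≤1 p)

    *-mono-r : ∀ {x y z} → 0# ≤ z → x ≤ y → x * z ≤ y * z
    *-mono-r {x} {y} {z} 0≤z x≤y = 0≤y-x⇒x≤y (resp refl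
      (trans (distribʳ z y (- x)) (+-congˡ (sym (Rng.-‿distribˡ-* x z))))
      (*-nonneg (0≤y-x x≤y) 0≤z))

    *-mono-l : ∀ {x y z} → 0# ≤ z → x ≤ y → z * x ≤ z * y
    *-mono-l {x} {y} {z} p q = resp (*-comm x z) (*-comm y z) (*-mono-r p q)

    x≤x+1 : ∀ x → x ≤ x + 1#
    x≤x+1 x = resp (+-identityʳ x) refl (+-mono ≤-refl 0≤1)

    x+1≰x : ∀ x → ¬ (x + 1# ≤ x)
    x+1≰x x p = 1≰0 (+-cancel x (resp (+-comm x 1#) (sym (+-identityˡ x)) p))

    ≰⇒≥ : ∀ {x y} → ¬ (x ≤ y) → y ≤ x
    ≰⇒≥ {x} {y} p with total x y
    ... | inj₁ q = contradiction q p
    ... | inj₂ q = q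

    fromℕ-mono : ∀ {m n} → m ℕ.≤ n → fromℕ m ≤ fromℕ n
    fromℕ-mono {n = zero}  z≤n     = ≤-refl
    fromℕ-mono {n = suc n} z≤n     =
      ≤-trans (fromℕ-mono {n = n} z≤n) (resp refl (+-comm (fromℕ n) 1#) (x≤x+1 _))
    fromℕ-mono             (s≤s p) = +-mono ≤-refl (fromℕ-mono p)

    fromℕ-reflect : ∀ {m n} → fromℕ m ≤ fromℕ n → m ℕ.≤ n
    fromℕ-reflect {m} {n} p with ℕ.≤-<-connex m n
    ... | inj₁ m≤n = m≤n
    ... | inj₂ n<m = contradiction
      (resp (+-comm 1# (fromℕ n)) refl (≤-trans (fromℕ-mono n<m) p)) (x+1≰x (fromℕ n))

    fromℤ-mono : ∀ {i j} → i ℤ.≤ j → fromℤ i ≤ fromℤ j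
    fromℤ-mono (-≤- n≤m) = neg-mono (fromℕ-mono (s≤s n≤m))
    fromℤ-mono (-≤+ {m} {n}) = ≤-trans
      (resp refl G.ε⁻¹≈ε (neg-mono (fromℕ-mono {n = suc m} z≤n))) (fromℕ-mono {n = n} z≤n)
    fromℤ-mono (+≤+ m≤n) = fromℕ-mono m≤n

    fromℤ-suc : ∀ i → fromℤ (ℤ.suc i) ≈ fromℤ i + 1#
    fromℤ-suc (+ n)          = +-comm 1# (fromℕ n)
    fromℤ-suc -[1+ zero ]    =
      sym (trans (+-congʳ (-‿cong (+-identityʳ 1#))) (-‿inverseˡ 1#))
    fromℤ-suc -[1+ suc n ]   = sym (begin
      - (1# + b) + 1#        ≈⟨ +-congʳ (-‿cong (+-comm 1# b)) ⟩
      - (b + 1#) + 1#        ≈⟨ +-congʳ (G.⁻¹-∙-comm b 1#) ⟨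
      (- b + - 1#) + 1#      ≈⟨ x-y+y (- b) 1# ⟩
      - b                    ∎)
      where
      open ≈R
      b = fromℕ (suc n)

    fromℤ-neg : ∀ n → fromℤ (ℤ.- (+ n)) ≈ - fromℕ n
    fromℤ-neg zero    = sym G.ε⁻¹≈ε
    fromℤ-neg (suc n) = refl

    archimedean : ∀ x → ∃[ n ] x ≤ fromℕ n
    archimedean x with em {P = ∃[ n ] x ≤ fromℕ n}
    ... | yes p = p
    ... | no ¬p = contradiction
      (≤-trans (+-monoˡ 1# (proj₂ s-sup (s + - 1#) below)) (≤-reflexive (x-y+y s 1#)))
      (x+1≰x s)
      where
      S : Pred ℝ 0ℓ
      S y = ∃[ n ] y ≡ fromℕ n
      lub : ∃ (IsSupremum totalOrder S)
      lub = complete S (0# , 0 , ≡.refl)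
        (x , λ { _ (n , ≡.refl) → ≰⇒≥ (λ x≤n → ¬p (n , x≤n)) })
      s = proj₁ lub
      s-sup = proj₂ lub
      below : IsUpperBound totalOrder S (s + - 1#)
      below _ (n , ≡.refl) = +-cancel 1# (resp (+-comm 1# (fromℕ n)) (sym (x-y+y s 1#))
        (proj₁ s-sup (fromℕ (suc n)) (suc n , ≡.refl)))

    floor-above : ∀ x n (k : ℤ) → fromℤ k ≤ x → x ≤ fromℤ (k ℤ.+ (+ n)) →
                  ∃[ j ] (fromℤ j ≤ x × x ≤ fromℤ j + 1#)
    floor-above x zero k k≤x x≤k = k , k≤x , ≤-trans
      (≡.subst (λ j → x ≤ fromℤ j) (ℤ.+-identityʳ k) x≤k) (x≤x+1 (fromℤ k))
    floor-above x (suc n) k k≤x x≤k+n with total x (fromℤ (ℤ.suc k))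
    ... | inj₁ x≤k+1 = k , k≤x , ≤-trans x≤k+1 (≤-reflexive (fromℤ-suc k))
    ... | inj₂ k+1≤x = floor-above x n (ℤ.suc k) k+1≤x
      (≡.subst (λ j → x ≤ fromℤ j) eq x≤k+n)
      where
      eq : k ℤ.+ (+ suc n) ≡ ℤ.suc k ℤ.+ (+ n)
      eq = ≡.trans (≡.sym (ℤ.+-assoc k (+ 1) (+ n))) (≡.cong (ℤ._+ (+ n)) (ℤ.+-comm k (+ 1)))

    floor : ∀ x → ∃[ j ] (fromℤ j ≤ x × x ≤ fromℤ j + 1#)
    floor x with archimedean x | archimedean (- x)
    ... | a , x≤a | b , -x≤b = floor-above x (b ℕ.+ a) (ℤ.- (+ b)) lower upper
      where
      lower : fromℤ (ℤ.- (+ b)) ≤ x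
      lower = resp (sym (fromℤ-neg b)) (G.⁻¹-involutive x) (neg-mono -x≤b)
      upper : x ≤ fromℤ (ℤ.- (+ b) ℤ.+ (+ (b ℕ.+ a)))
      upper = ≡.subst (λ j → x ≤ fromℤ j) (≡.sym eq) x≤a
        where
        eq : ℤ.- (+ b) ℤ.+ (+ (b ℕ.+ a)) ≡ + a
        eq = ≡.trans (≡.sym (ℤ.+-assoc (ℤ.- (+ b)) (+ b) (+ a)))
          (≡.trans (≡.cong (ℤ._+ (+ a)) (ℤ.+-inverseˡ (+ b))) (ℤ.+-identityˡ (+ a)))

    x≤∣x∣ : ∀ x → x ≤ ∣ x ∣
    x≤∣x∣ x with total x (- x)
    ... | inj₁ p = p
    ... | inj₂ p = ≤-refl

    -x≤∣x∣ : ∀ x → - x ≤ ∣ x ∣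
    -x≤∣x∣ x with total x (- x)
    ... | inj₁ p = ≤-refl
    ... | inj₂ p = p

    ∣x∣≤ : ∀ {x y} → x ≤ y → - x ≤ y → ∣ x ∣ ≤ y
    ∣x∣≤ {x} p q with total x (- x)
    ... | inj₁ _ = q
    ... | inj₂ _ = p

    dist-below : ∀ {x a b} → b ≤ a → a ≤ x → ∣ x + - a ∣ ≤ ∣ x + - b ∣
    dist-below {x} {a} {b} b≤a a≤x = ∣x∣≤ x-a≤
      (≤-trans (≤-trans (resp refl G.ε⁻¹≈ε (neg-mono (0≤y-x a≤x))) (0≤y-x a≤x)) x-a≤)
      where
      x-a≤ : x + - a ≤ ∣ x + - b ∣
      x-a≤ = ≤-trans (+-mono ≤-refl (neg-mono b≤a)) (x≤∣x∣ _)

    dist-above : ∀ {x a b} → a ≤ b → x ≤ a → ∣ x + - a ∣ ≤ ∣ x + - b ∣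
    dist-above {x} {a} {b} a≤b x≤a = ∣x∣≤
      (≤-trans (≤-trans (resp refl (-‿inverseʳ a) (+-monoˡ (- a) x≤a))
        (resp G.ε⁻¹≈ε refl (neg-mono (resp refl (-‿inverseʳ a) (+-monoˡ (- a) x≤a))))) a-x≤)
      a-x≤
      where
      a-x≤ : - (x + - a) ≤ ∣ x + - b ∣
      a-x≤ = ≤-trans (neg-mono (+-mono ≤-refl (neg-mono a≤b))) (-x≤∣x∣ _)

    0≤x^n : ∀ {x} n → 0# ≤ x → 0# ≤ x ^ n
    0≤x^n zero    p = 0≤1
    0≤x^n (suc n) p = *-nonneg p (0≤x^n n p)

    1≤x^n : ∀ {x} n → 1# ≤ x → 1# ≤ x ^ n
    1≤x^n zero    p = ≤-refl
    1≤x^n {x} (suc n) p = ≤-trans p (resp (*-identityʳ x) refl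
      (*-mono-l (≤-trans 0≤1 p) (1≤x^n n p)))

    ^-monoʳ : ∀ {x m n} → 1# ≤ x → m ℕ.≤ n → x ^ m ≤ x ^ n
    ^-monoʳ {n = n} p z≤n     = 1≤x^n n p
    ^-monoʳ         p (s≤s q) = *-mono-l (≤-trans 0≤1 p) (^-monoʳ p q)

    ^-monoˡ : ∀ {x y} n → 0# ≤ x → x ≤ y → x ^ n ≤ y ^ n
    ^-monoˡ zero    0≤x x≤y = ≤-refl
    ^-monoˡ (suc n) 0≤x x≤y =
      ≤-trans (*-mono-r (0≤x^n n 0≤x) x≤y) (*-mono-l (≤-trans 0≤x x≤y) (^-monoˡ n 0≤x x≤y))

    x^n≤1 : ∀ {x} n → 0# ≤ x → x ≤ 1# → x ^ n ≤ 1#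
    x^n≤1 zero    p q = ≤-refl
    x^n≤1 {x} (suc n) p q = ≤-trans (resp refl (*-identityʳ x) (*-mono-l p (x^n≤1 n p q))) q

    ^-reflectˡ : ∀ {y b} n → 1# ≤ b → 0# ≤ y → y ^ suc n ≤ b ^ suc n → y ≤ b
    ^-reflectˡ {y} {b} n 1≤b 0≤y p with total y b
    ... | inj₁ y≤b = y≤b
    ... | inj₂ b≤y = 0≤y-x⇒x≤y (resp G.ε⁻¹≈ε (G.⁻¹-anti-homo‿- y b) (neg-mono y-b≤0))
      where
      c = b ^ n
      y*c≤b*c : y * c ≤ b * c
      y*c≤b*c = ≤-trans (*-mono-l 0≤y (^-monoˡ n (≤-trans 0≤1 1≤b) b≤y)) p
      d*c≤0 : (y + - b) * c ≤ 0#
      d*c≤0 = resp (trans (+-congˡ (Rng.-‿distribˡ-* b c)) (sym (distribʳ c y (- b))))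
        (-‿inverseʳ (b * c)) (+-monoˡ (- (b * c)) y*c≤b*c)
      y-b≤0 : y + - b ≤ 0#
      y-b≤0 = ≤-trans (resp (*-identityʳ (y + - b)) refl
        (*-mono-l (0≤y-x b≤y) (1≤x^n n 1≤b))) d*c≤0

  open FieldLemmas

  abstract
    nearestInteger : ∀ x → ∃[ n ] (∀ m → ∣ x + - fromℤ n ∣ ≤ ∣ x + - fromℤ m ∣)
    nearestInteger x with floor x
    ... | k , k≤x , x≤k+1 with total ∣ x + - fromℤ k ∣ ∣ x + - fromℤ (ℤ.suc k) ∣
    ...   | near = choose near
      where
      x≤sk : x ≤ fromℤ (ℤ.suc k)
      x≤sk = ≤-trans x≤k+1 (≤-reflexive (sym (fromℤ-suc k)))
      Best : ℤ → Set
      Best n = ∀ m → ∣ x + - fromℤ n ∣ ≤ ∣ x + - fromℤ m ∣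
      best : ∀ n → ∣ x + - fromℤ n ∣ ≤ ∣ x + - fromℤ k ∣ →
             ∣ x + - fromℤ n ∣ ≤ ∣ x + - fromℤ (ℤ.suc k) ∣ → Best n
      best n p q m with m ℤ.≤? k
      ... | yes m≤k = ≤-trans p (dist-below (fromℤ-mono m≤k) k≤x)
      ... | no m≰k = ≤-trans q (dist-above (fromℤ-mono (ℤ.i<j⇒suc[i]≤j (ℤ.≰⇒> m≰k))) x≤sk)
      choose : ∣ x + - fromℤ k ∣ ≤ ∣ x + - fromℤ (ℤ.suc k) ∣ ⊎
               ∣ x + - fromℤ (ℤ.suc k) ∣ ≤ ∣ x + - fromℤ k ∣ → ∃ Best
      choose (inj₁ p) = k , best k ≤-refl p
      choose (inj₂ p) = ℤ.suc k , best (ℤ.suc k) p ≤-refl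

    minimizer : (f : ℕ → ℝ) (t : ℝ) → 1# ≤ t →
                ∃[ q ] ((1 ℕ.≤ q × fromℕ q ≤ t) ×
                        (∀ q′ → 1 ℕ.≤ q′ → fromℕ q′ ≤ t → f q ≤ f q′))
    minimizer f t 1≤t with archimedean t
    ... | N , t≤N with search N
      where
      search : ∀ n → ∃[ q ] ((1 ℕ.≤ q × fromℕ q ≤ t) ×
                 (∀ q′ → 1 ℕ.≤ q′ → fromℕ q′ ≤ t → q′ ℕ.≤ n → f q ≤ f q′))
      search zero = 1 , (ℕ.≤-refl , ≤-trans (≤-reflexive (+-identityʳ 1#)) 1≤t) ,
        λ q′ 1≤q′ _ q′≤0 → contradiction (ℕ.≤-trans 1≤q′ q′≤0) λ ()
      search (suc n) with search n | em {P = fromℕ (suc n) ≤ t}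
      ... | q , ok , min | no ¬p = q , ok , λ q′ a b c →
        [ (λ lt → min q′ a b (ℕ.s≤s⁻¹ lt)) , (λ { ≡.refl → contradiction b ¬p }) ]′
          (ℕ.m≤n⇒m<n∨m≡n c)
      ... | q , ok , min | yes p with total (f q) (f (suc n))
      ...   | inj₁ r = q , ok , λ q′ a b c →
        [ (λ lt → min q′ a b (ℕ.s≤s⁻¹ lt)) , (λ { ≡.refl → r }) ]′ (ℕ.m≤n⇒m<n∨m≡n c)
      ...   | inj₂ r = suc n , (s≤s z≤n , p) , λ q′ a b c →
        [ (λ lt → ≤-trans r (min q′ a b (ℕ.s≤s⁻¹ lt))) , (λ { ≡.refl → ≤-refl }) ]′
          (ℕ.m≤n⇒m<n∨m≡n c)
    ...   | q , ok , min = q , ok , λ q′ a b → min q′ a b (fromℕ-reflect (≤-trans b t≤N))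

    recip : ((t , _) : ℝ≥1) → ∃[ y ] t * y ≈ 1#
    recip (t , 1≤t) = inverse t λ t≈0 → 1≰0 (≤-trans 1≤t (≤-reflexive t≈0))

  infixr 8 _^ℤ_
  _^ℤ_ : ℝ≥1 → ℤ → ℝ
  t ^ℤ (+ n)    = proj₁ t ^ n
  t ^ℤ -[1+ n ] = proj₁ (recip t) ^ suc n

  -- The real power t ^ γ is the supremum of the rational powers t ^ (p / q)
  -- with p / q ≤ γ.  In turn t ^ (p / q) is the largest y ≥ 0 with
  -- y ^ q ≤ t ^ p; the set below contains all y ≥ 0 not exceeding such a power.
  PowerBelow : ℝ≥1 → ℝ → Pred ℝ 0ℓ
  PowerBelow t γ y =
    0# ≤ y × ∃[ p ] ∃[ q ] (1 ℕ.≤ q × fromℤ p ≤ q · γ × y ^ q ≤ t ^ℤ p)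

  module PowerLemmas where
    recip-nonneg : ∀ t → 0# ≤ proj₁ (recip t)
    recip-nonneg t@(t₀ , 1≤t) with recip t | total 0# (proj₁ (recip t))
    ... | y , ty≈1 | inj₁ p = p
    ... | y , ty≈1 | inj₂ p = contradiction
      (resp ty≈1 (zeroʳ t₀) (*-mono-l (≤-trans 0≤1 1≤t) p)) 1≰0

    recip-≤1 : ∀ t → proj₁ (recip t) ≤ 1#
    recip-≤1 t@(t₀ , 1≤t) = resp (*-identityˡ _) (proj₂ (recip t)) (*-mono-r (recip-nonneg t) 1≤t)

    ^ℤ-nonneg : ∀ t p → 0# ≤ t ^ℤ p
    ^ℤ-nonneg (t , 1≤t) (+ n)    = 0≤x^n n (≤-trans 0≤1 1≤t)
    ^ℤ-nonneg t         -[1+ n ] = 0≤x^n (suc n) (recip-nonneg t)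

    power-inhabited : ∀ t γ → ∃ (PowerBelow t γ)
    power-inhabited t γ with floor γ
    ... | p , p≤γ , _ = 0# , ≤-refl , p , 1 , ℕ.≤-refl ,
      ≤-trans p≤γ (≤-reflexive (sym (+-identityʳ γ))) ,
      ≤-trans (≤-reflexive (zeroˡ 1#)) (^ℤ-nonneg t p)

    ·-mono : ∀ {x y} n → x ≤ y → n · x ≤ n · y
    ·-mono zero    p = ≤-refl
    ·-mono (suc n) p = +-mono p (·-mono n p)

    power-bounded : ∀ t γ → ∃ (IsUpperBound totalOrder (PowerBelow t γ))
    power-bounded t@(t₀ , 1≤t) γ with archimedean γ
    ... | N , γ≤N = t₀ ^ N , bound
      where
      crude : ∀ p q → fromℤ p ≤ q · γ → t ^ℤ p ≤ t₀ ^ (N ℕ.* q)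
      crude (+ n) q p≤qγ = ^-monoʳ 1≤t (≡.subst (n ℕ.≤_) (ℕ.*-comm q N) (fromℕ-reflect
        (≤-trans p≤qγ (≤-trans (·-mono q γ≤N) (≤-reflexive (Mult.×-assocˡ 1# q N))))))
      crude -[1+ n ] q _ = ≤-trans (x^n≤1 (suc n) (recip-nonneg t) (recip-≤1 t)) (1≤x^n (N ℕ.* q) 1≤t)
      bound : IsUpperBound totalOrder (PowerBelow t γ) (t₀ ^ N)
      bound y (0≤y , p , suc q , _ , p≤qγ , y^q≤t^p) = ^-reflectˡ q (1≤x^n N 1≤t) 0≤y
        (≤-trans y^q≤t^p (≤-trans (crude p (suc q) p≤qγ)
          (≤-reflexive (sym (Exp.^-assocʳ t₀ N (suc q))))))

  open PowerLemmas

  abstract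
    power : (t : ℝ≥1) (γ : ℝ) → ∃ (IsSupremum totalOrder (PowerBelow t γ))
    power t γ = complete (PowerBelow t γ) (power-inhabited t γ) (power-bounded t γ)

  infixr 8 _^ℝ_
  _^ℝ_ : ℝ≥1 → ℝ → ℝ
  t ^ℝ γ = proj₁ (power t γ)

  ℝ̄ : Set
  ℝ̄ = ℝ ±

  open Relation.Binary.Construct.Add.Extrema.Equality _≈_ public using (_≈±_)
  private module ± = Relation.Binary.Construct.Add.Extrema.NonStrict _≤_
  open ± public using (_≤±_)

  totalOrder± : TotalOrder 0ℓ 0ℓ 0ℓ
  totalOrder± = record { isTotalOrder = ±.≤±-isTotalOrder isTotalOrder }

  open Relation.Binary.Properties.TotalOrder totalOrder± public using () renaming (_<_ to _<±_)
  open MinMax totalOrder± public using () renaming (_⊓_ to _⊓±_)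

  -- The value at ⊥± is never used: ϖ is compared with 1 before it is squared.
  infix 8 _²
  _² : ℝ̄ → ℝ̄
  ⊥±    ² = ⊤±
  [ x ] ² = [ x * x ]
  ⊤±    ² = ⊤±

  abstract
    supremum : (P : Pred ℝ̄ 0ℓ) → ∃ (IsSupremum totalOrder± P)
    supremum P with em {P = P ⊤±}
    ... | yes top = ⊤± , (λ x _ → x ±.≤⊤±) , λ u ub → ub ⊤± top
    ... | no ¬top with em {P = ∃[ x ] P [ x ]}
    ...   | no ¬fin = ⊥± , ub , λ u _ → ±.⊥±≤ u
      where
      ub : IsUpperBound totalOrder± P ⊥±
      ub ⊥±    _ = ±.⊥±≤ ⊥±
      ub [ x ] p = contradiction (x , p) ¬fin
      ub ⊤±    p = contradiction p ¬top
    ...   | yes fin with em {P = ∃ (IsUpperBound totalOrder (λ x → P [ x ]))}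
    ...     | no ¬bdd = ⊤± , (λ x _ → x ±.≤⊤±) , least
      where
      least : ∀ u → IsUpperBound totalOrder± P u → ⊤± ≤± u
      least ⊥±    ub = contradiction (ub [ proj₁ fin ] (proj₂ fin)) λ { Supremum≤.[ () ] }
      least [ u ] ub = contradiction (u , λ x p → ±.[≤]-injective (ub [ x ] p)) ¬bdd
      least ⊤±    ub = ⊤± ±.≤⊤±
    ...     | yes bdd with complete (λ x → P [ x ]) fin bdd
    ...       | s , s-ub , s-least = [ s ] , ub , least
      where
      ub : IsUpperBound totalOrder± P [ s ]
      ub ⊥±    _ = ±.⊥±≤ [ s ]
      ub [ x ] p = ±.[ s-ub x p ]
      ub ⊤±    p = contradiction p ¬top
      least : ∀ u → IsUpperBound totalOrder± P u → [ s ] ≤± u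
      least ⊥±    u-ub = contradiction (u-ub [ proj₁ fin ] (proj₂ fin)) λ { Supremum≤.[ () ] }
      least [ u ] u-ub = ±.[ s-least u (λ x p → ±.[≤]-injective (u-ub [ x ] p)) ]
      least ⊤±    u-ub = [ s ] ±.≤⊤±

    infimum : (P : Pred ℝ̄ 0ℓ) → ∃ (IsInfimum totalOrder± P)
    infimum P with supremum (λ l → IsLowerBound totalOrder± P l)
    ... | i , i-ub , i-least = i , (λ x p → i-least x (λ l lb → lb x p)) , i-ub

  sup : Pred ℝ̄ 0ℓ → ℝ̄
  sup P = proj₁ (supremum P)

  inf : Pred ℝ̄ 0ℓ → ℝ̄
  inf P = proj₁ (infimum P)

  supℝ : Pred ℝ 0ℓ → ℝ̄
  supℝ S = sup λ x → ∃[ γ ] (S γ × x ≡ [ γ ])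

  Tail : (ℝ≥1 → ℝ) → ℝ≥1 → Pred ℝ̄ 0ℓ
  Tail f T x = ∃[ t ] (proj₁ T ≤ proj₁ t × x ≡ [ f t ])

  liminf : (ℝ≥1 → ℝ) → ℝ̄
  liminf f = sup λ x → ∃[ T ] x ≡ inf (Tail f T)

  limsup : (ℝ≥1 → ℝ) → ℝ̄
  limsup f = inf λ x → ∃[ T ] x ≡ sup (Tail f T)

  Irrational : ℝ → Set
  Irrational x = ¬ (∃[ p ] ∃[ q ] (1 ℕ.≤ q × q · x ≈ fromℤ p))

  ‖_‖ : ℝ → ℝ
  ‖ x ‖ = ∣ x + - fromℤ (proj₁ (nearestInteger x)) ∣

  ψ : ℝ → ℝ≥1 → ℝ
  ψ θ (t , 1≤t) = ‖ proj₁ (minimizer (λ q → ‖ q · θ ‖) t 1≤t) · θ ‖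

  ψ₂ : ℝ → ℝ → ℝ≥1 → ℝ
  ψ₂ θ η t = ψ θ t ⊓ ψ η t

  ω : ℝ → ℝ̄
  ω θ = supℝ λ γ → liminf (λ t → t ^ℝ γ * ψ θ t) <± ⊤±

  ϖ : ℝ → ℝ → ℝ̄
  ϖ θ η = supℝ λ γ → limsup (λ t → t ^ℝ γ * ψ₂ θ η t) <± ⊤±

{-# OPTIONS --safe #-}

-- If q is a new minimum of ‖ · θ ‖, then ψ_θ ≥ 1 / (2 q) below q. Let ϖ > a / b > 1, so that
-- min (ψ_θ (t) , ψ_η (t)) ≪ t^(-a/b). For q^(b/a) ≪ t < q this forces ψ_η (t) ≪ t^(-a/b), and ψ_η
-- cannot drop in this range: a new minimum s of ‖ · η ‖ would give ψ_η ≥ 1 / (2 s) just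
-- below s, too much since a > b. Hence ψ_η (q^(b/a)) ≪ q^(-a/b), that is, ψ_η (t) ≪ t^(-a²/b²) for t ≈ q^(b/a).
-- Only arguments t = uᵇ with u natural are considered: then t^(a/b) is the integer uᵃ,
-- and no roots have to be extracted.

module Submission where

open import Defs
open import Level using (0ℓ)
open import Axiom.ExcludedMiddle using (ExcludedMiddle)
open import Relation.Nullary.Construct.Add.Extrema using ([_]; ⊥±; ⊤±)
open import Data.Integer.Base as ℤ using (ℤ; +_; -[1+_])
import Data.Integer.Properties as ℤ
open import Data.Nat.Base as ℕ using (ℕ; zero; suc; NonZero; z≤n; s≤s)
import Data.Nat.Properties as ℕ
open import Data.Nat.Induction using (<-rec)
open import Data.Nat.Solver using (module +-*-Solver)
open import Data.Product.Base using (∃; ∃-syntax; _×_; _,_; proj₁; proj₂)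
open import Data.Sum.Base as Sum using (_⊎_; inj₁; inj₂; swap)
open import Relation.Binary.Bundles using (TotalOrder)
open import Relation.Binary.Definitions using (tri<; tri≈; tri>)
open import Relation.Binary.PropositionalEquality.Core as ≡ using (_≡_)
open import Relation.Nullary.Decidable.Core using (yes; no)
open import Relation.Nullary.Negation.Core using (¬_; contradiction)
open import Relation.Unary using (Pred)
import Algebra.Properties.CommutativeMonoid.Mult
import Algebra.Properties.AbelianGroup
import Algebra.Properties.Semiring.Mult
import Relation.Binary.Construct.Add.Extrema.Equality
import Relation.Binary.Construct.Add.Extrema.NonStrict
import Relation.Binary.Construct.Add.Supremum.NonStrict as Supremum≤
import Relation.Binary.Reasoning.Setoid

-- Powers of natural numbers and integer roots.

module Powers where
  open import Data.Nat.Base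

  ^-distribʳ-* : ∀ m n k → (m * n) ^ k ≡ m ^ k * n ^ k
  ^-distribʳ-* m n zero    = ≡.refl
  ^-distribʳ-* m n (suc k) = ≡.trans (≡.cong (m * n *_) (^-distribʳ-* m n k))
    (solve 4 (λ m n x y → m :* n :* (x :* y) := m :* x :* (n :* y)) ≡.refl m n (m ^ k) (n ^ k))
    where open +-*-Solver

  ^-cancelˡ-< : ∀ k {m n} → m ^ k < n ^ k → m < n
  ^-cancelˡ-< k {m} {n} p with ℕ.≤-<-connex n m
  ... | inj₁ n≤m = contradiction p (ℕ.≤⇒≯ (ℕ.^-monoˡ-≤ k n≤m))
  ... | inj₂ m<n = m<n

  ^-cancelˡ-≤ : ∀ k .{{_ : NonZero k}} {m n} → m ^ k ≤ n ^ k → m ≤ n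
  ^-cancelˡ-≤ k {m} {n} p with ℕ.≤-<-connex m n
  ... | inj₁ m≤n = m≤n
  ... | inj₂ n<m = contradiction p (ℕ.<⇒≱ (ℕ.^-monoˡ-< k n<m))

  n≤n^k : ∀ n k .{{_ : NonZero k}} → n ≤ n ^ k
  n≤n^k zero    k       = z≤n
  n≤n^k (suc n) (suc k) = ℕ.m≤m*n (suc n) (suc n ^ k) {{ℕ.m^n≢0 (suc n) k}}

  -- Since `1 + n ≤ 2n`, rounding a root up instead of down costs only the constant factor `2 ^ k`.
  [1+n]^k≤2^k*n^k : ∀ k {n} → 1 ≤ n → suc n ^ k ≤ 2 ^ k * n ^ k
  [1+n]^k≤2^k*n^k k {n} 1≤n = ℕ.≤-trans
    (ℕ.^-monoˡ-≤ k (≡.subst (suc n ≤_) (≡.cong (λ m → n + m) (≡.sym (ℕ.+-identityʳ n))) (ℕ.+-monoˡ-≤ n 1≤n)))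
    (ℕ.≤-reflexive (^-distribʳ-* 2 n k))

  -- The strict side matters: if a function first drops at `n`, all arguments up to `u ^ k` precede
  -- the drop, while `suc u ^ k` has reached it.
  root : ∀ k .{{_ : NonZero k}} n → 1 ≤ n → ∃[ u ] (u ^ k < n × n ≤ suc u ^ k)
  root (suc k) (suc zero)    _ = 0 , s≤s z≤n , ℕ.m^n>0 1 (suc k)
  root k       (suc (suc n)) _ with root k (suc n) (s≤s z≤n)
  ... | u , u^k<n , n≤1+u^k with ℕ.m≤n⇒m<n∨m≡n n≤1+u^k
  ...   | inj₁ n<1+u^k = u , ℕ.<-trans u^k<n (ℕ.n<1+n _) , n<1+u^k
  ...   | inj₂ n≡1+u^k = suc u , ≡.subst (_< suc (suc n)) n≡1+u^k (ℕ.n<1+n _) ,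
    ≡.subst (_< suc (suc u) ^ k) (≡.sym n≡1+u^k) (ℕ.^-monoˡ-< k (ℕ.n<1+n (suc u)))

open Powers

module Proof (em : ExcludedMiddle 0ℓ) (ℝ-field : CompleteOrderedField) where
  open Diophantine em ℝ-field
  open FieldLemmas
  open PowerLemmas using (·-mono; recip-nonneg; recip-≤1)

  private
    module Mult where
      open Algebra.Properties.Semiring.Mult semiring public
      open Algebra.Properties.CommutativeMonoid.Mult +-commutativeMonoid public using (×-distrib-+)
    module G = Algebra.Properties.AbelianGroup +-abelianGroup
    module ≈± = Relation.Binary.Construct.Add.Extrema.Equality _≈_
    module ≤± = Relation.Binary.Construct.Add.Extrema.NonStrict _≤_
    module ≈R = Relation.Binary.Reasoning.Setoid setoid

  -- Natural multiples of reals and the embeddings of ℕ and ℤ.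

  ·-0 : ∀ n → n · 0# ≈ 0#
  ·-0 zero    = refl
  ·-0 (suc n) = trans (+-identityˡ _) (·-0 n)

  ·-nonneg : ∀ n {x} → 0# ≤ x → 0# ≤ n · x
  ·-nonneg n p = ≤-trans (≤-reflexive (sym (·-0 n))) (·-mono n p)

  ·-monoˡ : ∀ {m n x} → m ℕ.≤ n → 0# ≤ x → m · x ≤ n · x
  ·-monoˡ {n = n} z≤n     p = ·-nonneg n p
  ·-monoˡ         (s≤s q) p = +-mono ≤-refl (·-monoˡ q p)

  ·-fromℕ : ∀ m n → m · fromℕ n ≈ fromℕ (m ℕ.* n)
  ·-fromℕ = Mult.×-assocˡ 1#

  ·-inverseʳ : ∀ n x → n · x + n · (- x) ≈ 0#
  ·-inverseʳ n x = trans (sym (Mult.×-distrib-+ x (- x) n))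
    (trans (Mult.×-congʳ n (-‿inverseʳ x)) (·-0 n))

  ·-neg : ∀ n x → n · (- x) ≈ - (n · x)
  ·-neg n x = G.inverseʳ-unique (n · x) (n · (- x)) (·-inverseʳ n x)

  ·≈fromℕ* : ∀ n x → n · x ≈ fromℕ n * x
  ·≈fromℕ* n x = sym (trans (Mult.×-assoc-* n 1# x) (Mult.×-congʳ n (*-identityˡ x)))

  fromℕ-^ : ∀ m n → fromℕ (m ℕ.^ n) ≈ fromℕ m ^ n
  fromℕ-^ m zero    = +-identityʳ 1#
  fromℕ-^ m (suc n) = trans (Mult.×1-homo-* m (m ℕ.^ n)) (*-congˡ (fromℕ-^ m n))

  0≤fromℕ : ∀ n → 0# ≤ fromℕ n
  0≤fromℕ n = fromℕ-mono {n = n} z≤n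

  1≤fromℕ : ∀ {n} → 1 ℕ.≤ n → 1# ≤ fromℕ n
  1≤fromℕ p = ≤-trans (≤-reflexive (sym (+-identityʳ 1#))) (fromℕ-mono p)

  ≰0⇒≉0 : ∀ {x} → ¬ (x ≤ 0#) → ¬ (x ≈ 0#)
  ≰0⇒≉0 p q = p (≤-reflexive q)

  -- Strict inequality is expressed throughout as a failing `≤`. The multiplier is found by dividing
  -- `suc d` by `x`.
  archimedean-· : ∀ {x} → ¬ (x ≤ 0#) → ∀ d → ∃[ n ] ¬ (n · x ≤ fromℕ d)
  archimedean-· {x} x≰0 d with inverse x (≰0⇒≉0 x≰0)
  ... | y , xy≈1 with archimedean (y * fromℕ (suc d))
  ...   | n , p = n , λ q → ℕ.1+n≰n {d} (fromℕ-reflect {suc d} {d} (≤-trans above q))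
    where
    above : fromℕ (suc d) ≤ n · x
    above = resp
      (trans (sym (*-assoc x y _)) (trans (*-congʳ xy≈1) (*-identityˡ _)))
      (trans (*-comm x _) (sym (·≈fromℕ* n x)))
      (*-mono-l (≰⇒≥ x≰0) p)

  fromℤ-neg′ : ∀ i → fromℤ (ℤ.- i) ≈ - fromℤ i
  fromℤ-neg′ (+ n)    = fromℤ-neg n
  fromℤ-neg′ -[1+ n ] = sym (G.⁻¹-involutive _)

  fromℤ-· : ∀ n i → n · fromℤ i ≈ fromℤ (+ n ℤ.* i)
  fromℤ-· n (+ m)    = trans (·-fromℕ n m) (reflexive (≡.cong fromℤ (ℤ.pos-* n m)))
  fromℤ-· n -[1+ m ] = begin
    n · (- fromℕ (suc m))              ≈⟨ ·-neg n _ ⟩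
    - (n · fromℕ (suc m))              ≈⟨ -‿cong (fromℤ-· n (+ suc m)) ⟩
    - fromℤ (+ n ℤ.* + suc m)          ≈⟨ fromℤ-neg′ (+ n ℤ.* + suc m) ⟨
    fromℤ (ℤ.- (+ n ℤ.* + suc m))      ≡⟨ ≡.cong fromℤ (ℤ.neg-distribʳ-* (+ n) (+ suc m)) ⟩
    fromℤ (+ n ℤ.* -[1+ m ])           ∎
    where open ≈R

  -- Distinct integers are at least 1 apart; the lower bound in `gap` comes from this.
  fromℤ-trichotomy : ∀ i j → fromℤ i + 1# ≤ fromℤ j ⊎ fromℤ i ≈ fromℤ j ⊎ fromℤ j + 1# ≤ fromℤ i
  fromℤ-trichotomy i j with ℤ.<-cmp i j
  ... | tri< i<j _ _ = inj₁ (resp (fromℤ-suc i) refl (fromℤ-mono (ℤ.i<j⇒suc[i]≤j i<j)))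
  ... | tri≈ _ ≡.refl _ = inj₂ (inj₁ refl)
  ... | tri> _ _ j<i = inj₂ (inj₂ (resp (fromℤ-suc j) refl (fromℤ-mono (ℤ.i<j⇒suc[i]≤j j<i))))

  -- Absolute values and the distance to the nearest integer.

  0≤∣x∣ : ∀ x → 0# ≤ ∣ x ∣
  0≤∣x∣ x with total 0# x
  ... | inj₁ p = ≤-trans p (x≤∣x∣ x)
  ... | inj₂ p = ≤-trans (resp G.ε⁻¹≈ε refl (neg-mono p)) (-x≤∣x∣ x)

  ·-∣x∣≤ : ∀ n {x y} → n · x ≤ y → n · (- x) ≤ y → n · ∣ x ∣ ≤ y
  ·-∣x∣≤ n {x} p q with total x (- x)
  ... | inj₁ _ = q
  ... | inj₂ _ = p

  -- The two properties of q ↦ ‖ q · θ ‖ that are used. The second is the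
  -- continued fraction bound ‖ qₙ θ ‖ ≥ 1 / (2 qₙ₊₁), where q = qₙ₊₁ is a
  -- denominator at which a new minimum is attained.
  record Staircase (f : ℕ → ℝ) : Set where
    field
      positive : ∀ {q} → 1 ℕ.≤ q → ¬ (f q ≤ 0#)
      gap      : ∀ {q r} → 1 ℕ.≤ r → r ℕ.< q →
                 (∀ {i} → 1 ℕ.≤ i → i ℕ.< q → ¬ (f i ≤ f q)) →
                 1# ≤ (2 ℕ.* q) · f r

    nonneg : ∀ {q} → 1 ℕ.≤ q → 0# ≤ f q
    nonneg 1≤q = ≰⇒≥ (positive 1≤q)

  module _ {θ : ℝ} (irr : Irrational θ) where
    private
      P : ℕ → ℤ
      P q = proj₁ (nearestInteger (q · θ))

      -- The signed error: `∣ e q ∣` unfolds to `‖ q · θ ‖`.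
      e : ℕ → ℝ
      e q = q · θ + - fromℤ (P q)

      ∣x∣≤0⇒x≈0 : ∀ {x} → ∣ x ∣ ≤ 0# → x ≈ 0#
      ∣x∣≤0⇒x≈0 {x} p = antisym (≤-trans (x≤∣x∣ x) p)
        (resp G.ε⁻¹≈ε (G.⁻¹-involutive x) (neg-mono (≤-trans (-x≤∣x∣ x) p)))

      scaled : ∀ m n → fromℤ (+ m ℤ.* P n) + m · e n ≈ (m ℕ.* n) · θ
      scaled m n = begin
        fromℤ (+ m ℤ.* P n) + m · e n   ≈⟨ +-congʳ (fromℤ-· m (P n)) ⟨
        m · fromℤ (P n) + m · e n       ≈⟨ Mult.×-distrib-+ (fromℤ (P n)) (e n) m ⟨
        m · (fromℤ (P n) + e n)         ≈⟨ Mult.×-congʳ m (trans (+-comm _ _) (x-y+y _ _)) ⟩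
        m · (n · θ)                     ≈⟨ Mult.×-assocˡ θ m n ⟩
        (m ℕ.* n) · θ                   ∎
        where open ≈R

      -- Both sides equal `mnθ`, so the determinant `m P(n) - n P(m)` of two approximations is
      -- `n e(m) - m e(n)`.
      compare : ∀ m n → fromℤ (+ m ℤ.* P n) + m · e n ≈ fromℤ (+ n ℤ.* P m) + n · e m
      compare m n = trans (scaled m n)
        (trans (Mult.×-congˡ (ℕ.*-comm m n)) (sym (scaled n m)))

      -- The right side of the conclusion is `m x - n y = B - A`.
      separate : ∀ {A B} m n x y → A + m · x ≈ B + n · y → A + 1# ≤ B →
                 1# ≤ n · (- y) + m · x
      separate {A} {B} m n x y eq A+1≤B = +-cancel A (resp (+-comm A 1#)
        (begin
          B                             ≈⟨ +-identityʳ B ⟨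
          B + 0#                        ≈⟨ +-congˡ (·-inverseʳ n y) ⟨
          B + (n · y + n · (- y))       ≈⟨ +-assoc B _ _ ⟨
          B + n · y + n · (- y)         ≈⟨ +-congʳ eq ⟨
          A + m · x + n · (- y)         ≈⟨ +-comm _ _ ⟩
          n · (- y) + (A + m · x)       ≈⟨ +-congˡ (+-comm A _) ⟩
          n · (- y) + (m · x + A)       ≈⟨ +-assoc _ _ A ⟨
          n · (- y) + m · x + A         ∎) A+1≤B)
        where open ≈R

    staircase : Staircase (λ q → ‖ q · θ ‖)
    staircase = record { positive = pos ; gap = gap′ }
      where
      pos : ∀ {q} → 1 ℕ.≤ q → ¬ (‖ q · θ ‖ ≤ 0#)
      pos {q} 1≤q p = irr (P q , q , 1≤q , (begin
        q · θ                       ≈⟨ x-y+y _ _ ⟨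
        e q + fromℤ (P q)           ≈⟨ +-congʳ (∣x∣≤0⇒x≈0 p) ⟩
        0# + fromℤ (P q)            ≈⟨ +-identityˡ _ ⟩
        fromℤ (P q)                 ∎))
        where open ≈R
      gap′ : ∀ {q r} → 1 ℕ.≤ r → r ℕ.< q →
             (∀ {i} → 1 ℕ.≤ i → i ℕ.< q → ¬ (‖ i · θ ‖ ≤ ‖ q · θ ‖)) →
             1# ≤ (2 ℕ.* q) · ‖ r · θ ‖
      gap′ {q} {r} 1≤r r<q new = cases (fromℤ-trichotomy (+ q ℤ.* P r) (+ r ℤ.* P q))
        where
        eq≤er : ∣ e q ∣ ≤ ∣ e r ∣
        eq≤er = ≰⇒≥ (new 1≤r r<q)
        -- Both `r < q` and `∣ e q ∣ ≤ ∣ e r ∣` are used: `r ∣ e q ∣ + q ∣ e r ∣ ≤ 2 q ∣ e r ∣`.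
        bound : ∀ {x y} → x ≤ ∣ e q ∣ → y ≤ ∣ e r ∣ → r · x + q · y ≤ (2 ℕ.* q) · ∣ e r ∣
        bound x≤ y≤ = ≤-trans
          (+-mono (≤-trans (·-mono r (≤-trans x≤ eq≤er)) (·-monoˡ (ℕ.<⇒≤ r<q) (0≤∣x∣ (e r)))) (·-mono q y≤))
          (≤-reflexive (sym (trans (Mult.×-homo-+ _ q (q ℕ.+ 0)) (+-congˡ (Mult.×-congˡ (ℕ.+-identityʳ q))))))
        cases : fromℤ (+ q ℤ.* P r) + 1# ≤ fromℤ (+ r ℤ.* P q) ⊎
                fromℤ (+ q ℤ.* P r) ≈ fromℤ (+ r ℤ.* P q) ⊎
                fromℤ (+ r ℤ.* P q) + 1# ≤ fromℤ (+ q ℤ.* P r) →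
                1# ≤ (2 ℕ.* q) · ∣ e r ∣
        cases (inj₁ A<B) = ≤-trans (separate q r (e r) (e q) (compare q r) A<B)
          (bound (-x≤∣x∣ (e q)) (x≤∣x∣ (e r)))
        cases (inj₂ (inj₂ B<A)) = ≤-trans (separate r q (e q) (e r) (compare r q) B<A)
          (≤-trans (≤-reflexive (+-comm _ _)) (bound (x≤∣x∣ (e q)) (-x≤∣x∣ (e r))))
        -- A vanishing determinant gives `q · e r ≈ r · e q`. Then `(r + 1) ∣ e r ∣ ≤ q ∣ e r ∣ ≤ r
        -- ∣ e q ∣ ≤ r ∣ e r ∣`, so `∣ e r ∣ ≤ 0`, and `e q` would not be a new minimum.
        cases (inj₂ (inj₁ A≈B)) = contradiction
          (≤-trans (+-cancel (r · ∣ e r ∣) (≤-trans 1+r≤r (≤-reflexive (sym (+-identityˡ _))))) (0≤∣x∣ (e q)))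
          (new 1≤r r<q)
          where
          equal : q · e r ≈ r · e q
          equal = G.∙-cancelˡ _ _ _ (trans (+-congʳ (sym A≈B)) (compare q r))
          1+r≤r : suc r · ∣ e r ∣ ≤ r · ∣ e r ∣
          1+r≤r = ≤-trans (·-monoˡ r<q (0≤∣x∣ (e r))) (≤-trans
            (·-∣x∣≤ q (≤-trans (≤-reflexive equal) (·-mono r (x≤∣x∣ (e q))))
              (≤-trans (≤-reflexive (trans (·-neg q (e r)) (trans (-‿cong equal) (sym (·-neg r (e q))))))
                (·-mono r (-x≤∣x∣ (e q)))))
            (·-mono r eq≤er))

  -- Least witnesses and minima of sequences.

  leastWitness : (P : Pred ℕ 0ℓ) → (∀ n → ¬ P n) ⊎ ∃[ n ] (P n × (∀ {i} → i ℕ.< n → ¬ P i))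
  leastWitness P with em {P = ∃ P}
  ... | no ¬∃      = inj₁ λ n p → ¬∃ (n , p)
  ... | yes (n , p) = inj₂ (<-rec (λ n → P n → Least) step n p)
    where
    Least = ∃[ n ] (P n × (∀ {i} → i ℕ.< n → ¬ P i))
    step : ∀ n → (∀ {i} → i ℕ.< n → P i → Least) → P n → Least
    step n rec p with em {P = ∃[ i ] (i ℕ.< n × P i)}
    ... | yes (i , i<n , q) = rec i<n q
    ... | no ¬∃             = n , p , λ i<n q → ¬∃ (_ , i<n , q)

  ¬¬-elim : {A : Set} → ¬ ¬ A → A
  ¬¬-elim {A} ¬¬a with em {P = A}
  ... | yes a = a
  ... | no ¬a = contradiction ¬a ¬¬a

  -- The source of new minima: in the second case `f q < x ≤ f i` for every positive `i < q`.
  firstBelow : (f : ℕ → ℝ) (x : ℝ) →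
               (∀ {s} → 1 ℕ.≤ s → x ≤ f s) ⊎
               ∃[ q ] (1 ℕ.≤ q × ¬ (x ≤ f q) × (∀ {i} → 1 ℕ.≤ i → i ℕ.< q → x ≤ f i))
  firstBelow f x with leastWitness (λ s → 1 ℕ.≤ s × ¬ (x ≤ f s))
  ... | inj₁ none = inj₁ λ 1≤s → ¬¬-elim λ ¬p → none _ (1≤s , ¬p)
  ... | inj₂ (q , (1≤q , below) , first) =
    inj₂ (q , 1≤q , below , λ 1≤i i<q → ¬¬-elim λ ¬p → first i<q (1≤i , ¬p))

  argmin : (f : ℕ → ℝ) (n : ℕ) → 1 ℕ.≤ n →
           ∃[ q ] (1 ℕ.≤ q × q ℕ.≤ n × (∀ {i} → 1 ℕ.≤ i → i ℕ.≤ n → f q ≤ f i))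
  argmin f n 1≤n with minimizer f (fromℕ n) (1≤fromℕ 1≤n)
  ... | q , (1≤q , q≤n) , min =
    q , 1≤q , fromℕ-reflect q≤n , λ 1≤i i≤n → min _ 1≤i (fromℕ-mono i≤n)

  -- From `m ≤ m n x ≤ n d`. It plays an upper bound from `Good` against a lower bound from `gap`
  -- and leaves an inequality of natural numbers.
  cross : ∀ m n d {x} → m · x ≤ fromℕ d → 1# ≤ n · x → m ℕ.≤ n ℕ.* d
  cross m n d {x} p q = fromℕ-reflect {m} {n ℕ.* d} (≤-trans (·-mono m q) (resp
    (trans (Mult.×-assocˡ x n m) (trans (Mult.×-congˡ (ℕ.*-comm n m)) (sym (Mult.×-assocˡ x m n))))
    (·-fromℕ n d) (·-mono n p)))

  -- The transference argument for a fixed rational exponent a / b > 1.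

  module Exponents (a b D : ℕ) {{_ : NonZero b}} {{_ : NonZero D}} (b<a : b ℕ.< a) where
    private
      instance
        a≢0 : NonZero a
        a≢0 = ℕ.>-nonZero (ℕ.≤-<-trans z≤n b<a)
        ab≢0 : NonZero (a ℕ.* b)
        ab≢0 = ℕ.m*n≢0 a b

    -- For `q ≤ (1 + u)ᵇ` one has `2 q D ≤ threshold · uᵇ`; hence `u > threshold` makes `uᵃ` exceed
    -- `2 q D`.
    threshold : ℕ
    threshold = 2 ℕ.^ suc b ℕ.* D

    -- The factor `2ᵃ` pays for rounding `v` up, and `(4 D)ᵇ` dominates `threshold`.
    K : ℕ
    K = 2 ℕ.^ a ℕ.* (2 ℕ.* (2 ℕ.* D))

    1≤K : 1 ℕ.≤ K
    1≤K = ℕ.*-mono-≤ (ℕ.m^n>0 2 a) (ℕ.≤-trans (ℕ.>-nonZero⁻¹ D)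
      (ℕ.≤-trans (ℕ.m≤n*m D 2) (ℕ.m≤n*m (2 ℕ.* D) 2)))

    -- The spare factor `u` supplied by `b < a` is what absorbs the constants `threshold` and `K`.
    u*u^b≤u^a : ∀ {u} → 1 ℕ.≤ u → u ℕ.* u ℕ.^ b ℕ.≤ u ℕ.^ a
    u*u^b≤u^a {u} 1≤u = ℕ.^-monoʳ-≤ u {{ℕ.>-nonZero 1≤u}} b<a

    private
      2q≤ : ∀ {q u} → 1 ℕ.≤ u → q ℕ.≤ suc u ℕ.^ b → 2 ℕ.* q ℕ.* D ℕ.≤ threshold ℕ.* u ℕ.^ b
      2q≤ {q} {u} 1≤u q≤ = ℕ.≤-trans
        (ℕ.*-monoˡ-≤ D (ℕ.*-monoʳ-≤ 2 (ℕ.≤-trans q≤ ([1+n]^k≤2^k*n^k b 1≤u))))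
        (ℕ.≤-reflexive (solve 4 (λ t x y d → t :* (x :* y) :* d := t :* x :* d :* y) ≡.refl
          2 (2 ℕ.^ b) (u ℕ.^ b) D))
        where open +-*-Solver

    u^a≰2qD : ∀ {q u} → threshold ℕ.< u → q ℕ.≤ suc u ℕ.^ b → ¬ (u ℕ.^ a ℕ.≤ 2 ℕ.* q ℕ.* D)
    u^a≰2qD {q} {u} t<u q≤ p = ℕ.<⇒≱
      (ℕ.*-monoˡ-< (u ℕ.^ b) {{ℕ.m^n≢0 u b {{ℕ.>-nonZero 1≤u}}}} t<u)
      (ℕ.≤-trans (u*u^b≤u^a 1≤u) (ℕ.≤-trans p (2q≤ 1≤u q≤)))
      where 1≤u = ℕ.≤-<-trans z≤n t<u

    -- Proved by comparing `b`-th powers: `v` is about the `ab`-th root of `q` and `u` about its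
    -- `b`-th root, up to constants.
    v^a≤K*u : ∀ {q u v} → 1 ℕ.≤ u → 1 ℕ.≤ v → q ℕ.≤ suc u ℕ.^ b →
              v ℕ.^ (a ℕ.* b) ℕ.≤ 2 ℕ.* q ℕ.* D → suc v ℕ.^ a ℕ.≤ K ℕ.* u
    v^a≤K*u {q} {u} {v} 1≤u 1≤v q≤ v≤ = ^-cancelˡ-≤ b (begin
      (suc v ℕ.^ a) ℕ.^ b                             ≡⟨ ℕ.^-*-assoc (suc v) a b ⟩
      suc v ℕ.^ (a ℕ.* b)                             ≤⟨ [1+n]^k≤2^k*n^k (a ℕ.* b) 1≤v ⟩
      2 ℕ.^ (a ℕ.* b) ℕ.* v ℕ.^ (a ℕ.* b)             ≤⟨ ℕ.*-monoʳ-≤ (2 ℕ.^ (a ℕ.* b)) (ℕ.≤-trans v≤ (2q≤ 1≤u q≤)) ⟩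
      2 ℕ.^ (a ℕ.* b) ℕ.* (threshold ℕ.* u ℕ.^ b)     ≡⟨ ≡.cong (ℕ._* (threshold ℕ.* u ℕ.^ b)) (ℕ.^-*-assoc 2 a b) ⟨
      (2 ℕ.^ a) ℕ.^ b ℕ.* (threshold ℕ.* u ℕ.^ b)     ≤⟨ ℕ.*-monoʳ-≤ ((2 ℕ.^ a) ℕ.^ b) (ℕ.*-monoˡ-≤ (u ℕ.^ b) t≤) ⟩
      (2 ℕ.^ a) ℕ.^ b ℕ.* ((2 ℕ.* (2 ℕ.* D)) ℕ.^ b ℕ.* u ℕ.^ b)
                                                      ≡⟨ ℕ.*-assoc ((2 ℕ.^ a) ℕ.^ b) _ _ ⟨
      (2 ℕ.^ a) ℕ.^ b ℕ.* (2 ℕ.* (2 ℕ.* D)) ℕ.^ b ℕ.* u ℕ.^ b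
                                                      ≡⟨ ≡.cong (ℕ._* u ℕ.^ b) (^-distribʳ-* (2 ℕ.^ a) (2 ℕ.* (2 ℕ.* D)) b) ⟨
      K ℕ.^ b ℕ.* u ℕ.^ b                             ≡⟨ ^-distribʳ-* K u b ⟨
      (K ℕ.* u) ℕ.^ b                                 ∎)
      where
      open ℕ.≤-Reasoning
      t≤ : threshold ℕ.≤ (2 ℕ.* (2 ℕ.* D)) ℕ.^ b
      t≤ = begin
        2 ℕ.^ suc b ℕ.* D             ≡⟨ solve 3 (λ t x d → t :* x :* d := x :* (t :* d)) ≡.refl 2 (2 ℕ.^ b) D ⟩
        2 ℕ.^ b ℕ.* (2 ℕ.* D)         ≤⟨ ℕ.*-monoʳ-≤ (2 ℕ.^ b) (n≤n^k (2 ℕ.* D) b) ⟩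
        2 ℕ.^ b ℕ.* (2 ℕ.* D) ℕ.^ b   ≡⟨ ^-distribʳ-* 2 (2 ℕ.* D) b ⟨
        (2 ℕ.* (2 ℕ.* D)) ℕ.^ b       ∎
        where open +-*-Solver

    -- With `t = uᵇ`, this says that the minimum of `f` up to `t` is at most `D t^(-a/b)`, free of
    -- roots and division.
    Good : (ℕ → ℝ) → ℕ → Set
    Good f u = ∃[ s ] (1 ℕ.≤ s × s ℕ.≤ u ℕ.^ b × (u ℕ.^ a) · f s ≤ fromℕ D)

    -- A new minimum of g between u₀ᵇ and u₁ᵇ would force g s₀ ≥ 1 / (2 (1 + u)ᵇ)
    -- for some u ∈ [u₀ , u₁), which is incompatible with g s₀ ≤ D / uᵃ since a > b.
    stable : ∀ {g} → Staircase g → ∀ {u₀} → threshold ℕ.< u₀ →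
             ∃[ s₀ ] (1 ℕ.≤ s₀ × s₀ ℕ.≤ u₀ ℕ.^ b ×
               (∀ {u₁} → u₀ ℕ.≤ u₁ → (∀ {u} → u₀ ℕ.≤ u → u ℕ.≤ u₁ → Good g u) →
                (u₁ ℕ.^ a) · g s₀ ≤ fromℕ D))
    stable {g} sc {u₀} t<u₀ with argmin g (u₀ ℕ.^ b) (ℕ.m^n>0 u₀ {{ℕ.>-nonZero (ℕ.≤-<-trans z≤n t<u₀)}} b)
    -- The point `s₀` is fixed before `u₁`, so `u₁` may later be chosen depending on `g s₀`.
    ... | s₀ , 1≤s₀ , s₀≤ , min = s₀ , 1≤s₀ , s₀≤ , λ u₀≤u₁ good → extend u₀≤u₁ good (firstBelow g (g s₀))
      where
      reach : ∀ {u} → Good g u → (∀ {s} → 1 ℕ.≤ s → s ℕ.≤ u ℕ.^ b → g s₀ ≤ g s) →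
              (u ℕ.^ a) · g s₀ ≤ fromℕ D
      reach {u} (s , 1≤s , s≤ , p) min′ = ≤-trans (·-mono (u ℕ.^ a) (min′ 1≤s s≤)) p
      extend : ∀ {u₁} → u₀ ℕ.≤ u₁ → (∀ {u} → u₀ ℕ.≤ u → u ℕ.≤ u₁ → Good g u) →
               (∀ {s} → 1 ℕ.≤ s → g s₀ ≤ g s) ⊎
               ∃[ q ] (1 ℕ.≤ q × ¬ (g s₀ ≤ g q) × (∀ {i} → 1 ℕ.≤ i → i ℕ.< q → g s₀ ≤ g i)) →
               (u₁ ℕ.^ a) · g s₀ ≤ fromℕ D
      extend u₀≤u₁ good (inj₁ all) = reach (good u₀≤u₁ ℕ.≤-refl) λ 1≤s _ → all 1≤s
      extend {u₁} u₀≤u₁ good (inj₂ (q , 1≤q , below , first)) with ℕ.≤-<-connex q (u₁ ℕ.^ b)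
      ... | inj₂ u₁^b<q = reach (good u₀≤u₁ ℕ.≤-refl) λ 1≤s s≤ → first 1≤s (ℕ.≤-<-trans s≤ u₁^b<q)
      ... | inj₁ q≤u₁^b with root b q 1≤q
      ...   | u , u^b<q , q≤1+u^b = contradiction
        (cross (u ℕ.^ a) (2 ℕ.* q) D
          (reach (good u₀≤u u≤u₁) λ 1≤s s≤ → first 1≤s (ℕ.≤-<-trans s≤ u^b<q))
          (Staircase.gap sc 1≤s₀ s₀<q λ 1≤i i<q p → below (≤-trans (first 1≤i i<q) p)))
        (u^a≰2qD (ℕ.<-≤-trans t<u₀ u₀≤u) q≤1+u^b)
        where
        u₀^b<q : u₀ ℕ.^ b ℕ.< q
        u₀^b<q = ℕ.≰⇒> λ q≤ → below (min 1≤q q≤)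
        u₀≤u : u₀ ℕ.≤ u
        u₀≤u = ℕ.s≤s⁻¹ (^-cancelˡ-< b (ℕ.<-≤-trans u₀^b<q q≤1+u^b))
        u≤u₁ : u ℕ.≤ u₁
        u≤u₁ = ℕ.<⇒≤ (^-cancelˡ-< b (ℕ.<-≤-trans u^b<q q≤u₁^b))
        s₀<q : s₀ ℕ.< q
        s₀<q = ℕ.≤-<-trans s₀≤ u₀^b<q

    module _ {f g : ℕ → ℝ} (sf : Staircase f) (sg : Staircase g) (U : ℕ)
             (good : ∀ {u} → U ℕ.≤ u → Good f u ⊎ Good g u) where

      -- If f had a positive lower bound, then g would be the good function from some
      -- point on, hence constant there, and would have to vanish.
      unbounded-below : ∀ {c} → ¬ (c ≤ 0#) → ¬ (∀ {s} → 1 ℕ.≤ s → c ≤ f s)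
      unbounded-below {c} c≰0 c≤f with archimedean-· c≰0 D
      ... | n , large with stable sg {suc (U ℕ.+ n ℕ.+ threshold)} (s≤s (ℕ.m≤n+m threshold (U ℕ.+ n)))
      ...   | s₀ , 1≤s₀ , _ , extend with archimedean-· (Staircase.positive sg 1≤s₀) D
      -- With `u₁ = u₀ + m`, stability gives `m · g s₀ ≤ u₁ᵃ · g s₀ ≤ D`, against the choice of `m`.
      ...     | m , large′ = large′ (≤-trans
        (·-monoˡ (ℕ.≤-trans (ℕ.m≤n+m m u₀) (n≤n^k (u₀ ℕ.+ m) a)) (Staircase.nonneg sg 1≤s₀))
        (extend (ℕ.m≤m+n u₀ m) λ u₀≤u _ → good-g u₀≤u))
        where
        u₀ = suc (U ℕ.+ n ℕ.+ threshold)
        good-g : ∀ {u} → u₀ ℕ.≤ u → Good g u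
        good-g {u} u₀≤u with good (ℕ.≤-trans (ℕ.≤-trans (ℕ.m≤m+n U n) (ℕ.≤-trans (ℕ.m≤m+n (U ℕ.+ n) threshold) (ℕ.n≤1+n _))) u₀≤u)
        ... | inj₂ p = p
        ... | inj₁ (s , 1≤s , _ , p) = contradiction
          (≤-trans (·-monoˡ (ℕ.≤-trans n≤u (n≤n^k u a)) (≰⇒≥ c≰0))
            (≤-trans (·-mono (u ℕ.^ a) (c≤f 1≤s)) p)) large
          where
          n≤u : n ℕ.≤ u
          n≤u = ℕ.≤-trans (ℕ.≤-trans (ℕ.m≤n+m n U) (ℕ.≤-trans (ℕ.m≤m+n (U ℕ.+ n) threshold) (ℕ.n≤1+n _))) u₀≤u

      -- By `unbounded-below`, `f` cannot stay above its positive minimum over an initial segment;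
      -- the first drop below it is a new minimum, and `gap` applies there.
      newMinimum : ∀ M → ∃[ q ] (M ℕ.< q × (∀ {r} → 1 ℕ.≤ r → r ℕ.< q → 1# ≤ (2 ℕ.* q) · f r))
      -- Taking `suc M` keeps the segment nonempty when `M` is 0.
      newMinimum M with argmin f (suc M) (s≤s z≤n)
      ... | m , 1≤m , m≤ , min with firstBelow f (f m)
      ...   | inj₁ all = contradiction (λ {s} → all {s}) (unbounded-below (Staircase.positive sf 1≤m))
      ...   | inj₂ (q , 1≤q , below , first) =
        q , ℕ.≰⇒> (λ q≤M → below (min 1≤q (ℕ.m≤n⇒m≤1+n q≤M))) ,
        λ 1≤r r<q → Staircase.gap sf 1≤r r<q λ 1≤i i<q p → below (≤-trans (first 1≤i i<q) p)

      -- Below a new minimum q of f, the function f is not good at u with uᵃ > 2 q D and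
      -- uᵇ < q, so g is good, and constant, from u = vᵇ ≈ q^(1/a) up to u₁ ≈ q^(1/b).
      squareExponent : ∀ T → ∃[ v ] (T ℕ.≤ v ×
        ∃[ s ] (1 ℕ.≤ s × s ℕ.≤ v ℕ.^ (b ℕ.* b) × (v ℕ.^ (a ℕ.* a)) · g s ≤ fromℕ (K ℕ.^ a ℕ.* D)))
      -- The base of this power dominates `T`, `U`, `threshold` and `K`, and `q` beyond the power
      -- pushes `v` beyond the base.
      squareExponent T with newMinimum ((suc (T ℕ.+ U ℕ.+ threshold ℕ.+ K)) ℕ.^ (a ℕ.* b))
      -- The root of `1 + 2 q D` makes `v = suc w` satisfy `vᵃᵇ > 2 q D` strictly, so `f` fails to
      -- be good from `u = vᵇ` on; `u₁` is the last `u` with `uᵇ < q`.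
      ... | q , M<q , 1≤2q·f with root (a ℕ.* b) (suc (2 ℕ.* q ℕ.* D)) (s≤s z≤n) | root b q (ℕ.≤-<-trans z≤n M<q)
      ...   | w , w^ab< , <v^ab | u₁ , u₁^b<q , q≤1+u₁^b =
        v , ℕ.≤-trans T≤N N≤v , proj₁ st , proj₁ (proj₂ st) ,
        ≡.subst (proj₁ st ℕ.≤_) (ℕ.^-*-assoc v b b) (proj₁ (proj₂ (proj₂ st))) , bound
        where
        N = suc (T ℕ.+ U ℕ.+ threshold ℕ.+ K)
        v = suc w
        N≤w : N ℕ.≤ w
        N≤w = ℕ.s≤s⁻¹ (^-cancelˡ-< (a ℕ.* b) (ℕ.<-≤-trans M<q (ℕ.≤-trans
          (ℕ.≤-trans (ℕ.m≤n*m q 2) (ℕ.m≤m*n (2 ℕ.* q) D)) (ℕ.≤-trans (ℕ.n≤1+n _) <v^ab))))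
        N≤v : N ℕ.≤ v
        N≤v = ℕ.m≤n⇒m≤1+n N≤w
        K≤N : K ℕ.≤ N
        K≤N = ℕ.m≤n⇒m≤1+n (ℕ.m≤n+m K (T ℕ.+ U ℕ.+ threshold))
        t<N : threshold ℕ.< N
        t<N = s≤s (ℕ.≤-trans (ℕ.m≤n+m threshold (T ℕ.+ U)) (ℕ.m≤m+n _ K))
        T+U≤N : T ℕ.+ U ℕ.≤ N
        T+U≤N = ℕ.m≤n⇒m≤1+n (ℕ.≤-trans (ℕ.m≤m+n (T ℕ.+ U) threshold) (ℕ.m≤m+n _ K))
        T≤N : T ℕ.≤ N
        T≤N = ℕ.≤-trans (ℕ.m≤m+n T U) T+U≤N
        N≤v^b : N ℕ.≤ v ℕ.^ b
        N≤v^b = ℕ.≤-trans N≤v (n≤n^k v b)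
        st = stable sg (ℕ.<-≤-trans t<N N≤v^b)
        1≤u₁ : 1 ℕ.≤ u₁
        1≤u₁ = ℕ.s≤s⁻¹ (^-cancelˡ-< b (≡.subst (ℕ._< suc u₁ ℕ.^ b) (≡.sym (ℕ.^-zeroˡ b))
          (ℕ.<-≤-trans (ℕ.≤-<-trans (ℕ.m^n>0 N (a ℕ.* b)) M<q) q≤1+u₁^b)))
        v^a≤ : v ℕ.^ a ℕ.≤ K ℕ.* u₁
        v^a≤ = v^a≤K*u 1≤u₁ (ℕ.≤-trans (s≤s z≤n) N≤w) q≤1+u₁^b (ℕ.s≤s⁻¹ w^ab<)
        -- The range of `u` is nonempty: `K vᵇ ≤ v vᵇ ≤ vᵃ ≤ K u₁`, and `K` cancels.
        v^b≤u₁ : v ℕ.^ b ℕ.≤ u₁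
        v^b≤u₁ = ℕ.*-cancelˡ-≤ K {{ℕ.>-nonZero 1≤K}} (ℕ.≤-trans
          (ℕ.*-monoˡ-≤ (v ℕ.^ b) (ℕ.≤-trans K≤N N≤v)) (ℕ.≤-trans (u*u^b≤u^a (s≤s z≤n)) v^a≤))
        good-g : ∀ {u} → v ℕ.^ b ℕ.≤ u → u ℕ.≤ u₁ → Good g u
        good-g {u} v^b≤u u≤u₁ with good (ℕ.≤-trans (ℕ.≤-trans (ℕ.m≤n+m U T) T+U≤N) (ℕ.≤-trans N≤v^b v^b≤u))
        ... | inj₂ p = p
        ... | inj₁ (s , 1≤s , s≤ , p) = contradiction
          (cross (u ℕ.^ a) (2 ℕ.* q) D p (1≤2q·f 1≤s (ℕ.≤-<-trans s≤ (ℕ.≤-<-trans (ℕ.^-monoˡ-≤ b u≤u₁) u₁^b<q))))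
          (ℕ.<⇒≱ (ℕ.<-≤-trans <v^ab (≡.subst (ℕ._≤ u ℕ.^ a)
            (≡.trans (ℕ.^-*-assoc v b a) (≡.cong (v ℕ.^_) (ℕ.*-comm b a))) (ℕ.^-monoˡ-≤ a v^b≤u))))
        -- The exponent is squared here: `g` at the stable point is at most `D / u₁ᵃ`, and `u₁` is
        -- at least `vᵃ / K`.
        v^aa≤ : v ℕ.^ (a ℕ.* a) ℕ.≤ K ℕ.^ a ℕ.* u₁ ℕ.^ a
        v^aa≤ = ≡.subst₂ ℕ._≤_ (ℕ.^-*-assoc v a a) (^-distribʳ-* K u₁ a) (ℕ.^-monoˡ-≤ a v^a≤)
        bound : (v ℕ.^ (a ℕ.* a)) · g (proj₁ st) ≤ fromℕ (K ℕ.^ a ℕ.* D)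
        bound = ≤-trans (·-monoˡ v^aa≤ (Staircase.nonneg sg (proj₁ (proj₂ st))))
          (≤-trans (≤-reflexive (sym (Mult.×-assocˡ _ (K ℕ.^ a) (u₁ ℕ.^ a))))
            (≤-trans (·-mono (K ℕ.^ a) (proj₂ (proj₂ (proj₂ st)) v^b≤u₁ good-g))
              (≤-reflexive (·-fromℕ (K ℕ.^ a) D))))

  -- Division by naturals, and real powers at perfect powers.

  ·-cancelˡ-≤ : ∀ n .{{_ : NonZero n}} {x y} → n · x ≤ n · y → x ≤ y
  ·-cancelˡ-≤ (suc n) {x} {y} p with total x y
  ... | inj₁ x≤y = x≤y
  ... | inj₂ y≤x = +-cancel (n · y) (≤-trans (+-mono ≤-refl (·-mono n y≤x)) p)

  ·-divide : ∀ n .{{_ : NonZero n}} x → ∃[ y ] n · y ≈ x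
  ·-divide (suc n) x with inverse (fromℕ (suc n)) (λ p → 1≰0 (≤-trans (1≤fromℕ {suc n} (s≤s z≤n)) (≤-reflexive p)))
  ... | i , ni≈1 = i * x , trans (·≈fromℕ* (suc n) (i * x))
    (trans (sym (*-assoc _ i x)) (trans (*-congʳ ni≈1) (*-identityˡ x)))

  *-·-· : ∀ m n x y → (m · x) * (n · y) ≈ (m ℕ.* n) · (x * y)
  *-·-· m n x y = trans (Mult.×-assoc-* m x (n · y))
    (trans (Mult.×-congʳ m (Mult.×-comm-* n x y)) (Mult.×-assocˡ (x * y) m n))

  natural : ∀ n → 1 ℕ.≤ n → ℝ≥1
  natural n 1≤n = fromℕ n , 1≤fromℕ 1≤n

  fromℕ-^-^ : ∀ u m n → fromℕ (u ℕ.^ m) ^ n ≈ fromℕ (u ℕ.^ (m ℕ.* n))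
  fromℕ-^-^ u m n = trans (sym (fromℕ-^ (u ℕ.^ m) n)) (reflexive (≡.cong fromℕ (ℕ.^-*-assoc u m n)))

  -- As `(uᵃ)ᵇ = (uᵇ)ᵃ`, the number `uᵃ` lies in the set whose supremum is the power, with exponent
  -- a / b.
  u^a≤[u^b]^γ : ∀ {u a b γ} (p : 1 ℕ.≤ u ℕ.^ b) → 1 ℕ.≤ b → fromℕ a ≤ b · γ →
                fromℕ (u ℕ.^ a) ≤ natural (u ℕ.^ b) p ^ℝ γ
  u^a≤[u^b]^γ {u} {a} {b} {γ} p 1≤b a≤bγ = proj₁ (proj₂ (power (natural (u ℕ.^ b) p) γ)) _
    (0≤fromℕ (u ℕ.^ a) , + a , b , 1≤b , a≤bγ , ≤-reflexive (trans (fromℕ-^-^ u a b)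
      (trans (reflexive (≡.cong (λ k → fromℕ (u ℕ.^ k)) (ℕ.*-comm a b))) (sym (fromℕ-^-^ u b a)))))

  -- Any fraction `r / q ≤ γ` has `b r ≤ a q`, so `(uᵇ)ʳ ≤ (uᵃ)^q`; negative `r` give powers at most
  -- 1.
  [u^b]^γ≤u^a : ∀ {u a b γ} (p : 1 ℕ.≤ u ℕ.^ b) → 1 ℕ.≤ u → b · γ ≤ fromℕ a →
                natural (u ℕ.^ b) p ^ℝ γ ≤ fromℕ (u ℕ.^ a)
  [u^b]^γ≤u^a {u} {a} {b} {γ} p 1≤u bγ≤a = proj₂ (proj₂ (power t γ)) _ bound
    where
    t = natural (u ℕ.^ b) p
    instance
      u≢0 : NonZero u
      u≢0 = ℕ.>-nonZero 1≤u
    1≤u^a : 1# ≤ fromℕ (u ℕ.^ a)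
    1≤u^a = 1≤fromℕ (ℕ.m^n>0 u a)
    power≤ : ∀ r q → fromℤ r ≤ q · γ → t ^ℤ r ≤ fromℕ (u ℕ.^ a) ^ q
    power≤ -[1+ n ] q _ = ≤-trans (x^n≤1 (suc n) (recip-nonneg t) (recip-≤1 t)) (1≤x^n q 1≤u^a)
    power≤ (+ n) q n≤qγ = resp (sym (fromℕ-^-^ u b n)) (sym (fromℕ-^-^ u a q))
      (fromℕ-mono (ℕ.^-monoʳ-≤ u bn≤aq))
      where
      bn≤aq : b ℕ.* n ℕ.≤ a ℕ.* q
      bn≤aq = ≡.subst (b ℕ.* n ℕ.≤_) (ℕ.*-comm q a) (fromℕ-reflect {b ℕ.* n} {q ℕ.* a} (resp (·-fromℕ b n) (·-fromℕ q a)
        (≤-trans (·-mono b n≤qγ) (≤-trans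
          (≤-reflexive (trans (Mult.×-assocˡ γ b q)
            (trans (Mult.×-congˡ (ℕ.*-comm b q)) (sym (Mult.×-assocˡ γ q b)))))
          (·-mono q bγ≤a)))))
    bound : ∀ y → PowerBelow t γ y → y ≤ fromℕ (u ℕ.^ a)
    bound y (0≤y , r , suc q , _ , r≤qγ , y^q≤) =
      ^-reflectˡ q 1≤u^a 0≤y (≤-trans y^q≤ (power≤ r (suc q) r≤qγ))

  -- Finiteness of upper and lower limits.

  ≤[]⇒<⊤ : ∀ {x c} → x ≤± [ c ] → x <± ⊤±
  ≤[]⇒<⊤ {⊥±}    _ = ⊥± ≤±.≤⊤± , λ ()
  ≤[]⇒<⊤ {[ x ]} _ = [ x ] ≤±.≤⊤± , λ ()

  <⊤⇒⊤≰ : ∀ {x} → x <± ⊤± → ¬ (⊤± ≤± x)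
  <⊤⇒⊤≰ {⊤±} (_ , ≉) _ = ≉ ≈±.⊤±≈⊤±

  -- Were every tail unbounded above, each tail supremum, and so their infimum, would be `⊤±`.
  limsup<⊤ : ∀ f → limsup f <± ⊤± → ∃[ T ] ∃[ c ] (∀ t → proj₁ T ≤ proj₁ t → f t ≤ c)
  limsup<⊤ f p = ¬¬-elim λ ¬bdd → <⊤⇒⊤≰ p (proj₂ (proj₂ (infimum _)) ⊤± λ { _ (T , ≡.refl) → top ¬bdd T })
    where
    top : ¬ (∃[ T ] ∃[ c ] (∀ t → proj₁ T ≤ proj₁ t → f t ≤ c)) → ∀ T → ⊤± ≤± sup (Tail f T)
    top ¬bdd T with supremum (Tail f T)
    -- A supremum `⊥±` would leave the tail without values, so any constant bounds it; `0#` is an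
    -- arbitrary choice.
    ... | ⊥±    , ub , _ = contradiction (T , 0# , λ t q → contradiction (ub [ f t ] (t , q , ≡.refl)) λ { Supremum≤.[ () ] }) ¬bdd
    ... | [ c ] , ub , _ = contradiction (T , c , λ t q → ≤±.[≤]-injective (ub [ f t ] (t , q , ≡.refl))) ¬bdd
    ... | ⊤±    , _      = ⊤± ≤±.≤⊤±

  liminf≤ : ∀ f c → (∀ T → ∃[ t ] (proj₁ T ≤ proj₁ t × f t ≤ c)) → liminf f ≤± [ c ]
  liminf≤ f c often = proj₂ (proj₂ (supremum _)) [ c ] λ { _ (T , ≡.refl) → tail T }
    where
    tail : ∀ T → inf (Tail f T) ≤± [ c ]
    tail T with often T
    ... | t , T≤t , ft≤c = ≤±.≤±-trans ≤-trans
      (proj₁ (proj₂ (infimum (Tail f T))) [ f t ] (t , T≤t , ≡.refl)) ≤±.[ ft≤c ]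

  -- Between the exponents and the transference argument.

  ϖ-Set : ℝ → ℝ → Pred ℝ 0ℓ
  ϖ-Set θ η γ = limsup (λ t → t ^ℝ γ * ψ₂ θ η t) <± ⊤±

  ω-Set : ℝ → Pred ℝ 0ℓ
  ω-Set θ γ = liminf (λ t → t ^ℝ γ * ψ θ t) <± ⊤±

  ψ-nonneg : ∀ θ t → 0# ≤ ψ θ t
  ψ-nonneg θ t = 0≤∣x∣ _

  ⊓-elim : ∀ (P : Pred ℝ 0ℓ) x y → P (x ⊓ y) → P x ⊎ P y
  ⊓-elim P x y p with total x y
  ... | inj₁ _ = inj₁ p
  ... | inj₂ _ = inj₂ p

  module Rational {a b : ℕ} {{_ : NonZero b}} (b<a : b ℕ.< a) where
    private
      1≤b : 1 ℕ.≤ b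
      1≤b = ℕ.>-nonZero⁻¹ b

    -- The limsup bound is read off at `t = uᵇ`, where `uᵃ ≤ t ^ℝ γ`; the minimizer behind `ψ` is
    -- the witness for `Good`. The constant is `suc D` because `Exponents` asks for a nonzero one.
    eventuallyGood : ∀ {θ η γ} T c U D → fromℕ a ≤ b · γ →
      (∀ t → T ≤ proj₁ t → t ^ℝ γ * ψ₂ θ η t ≤ c) → T ≤ fromℕ U → c ≤ fromℕ D →
      ∀ {u} → suc U ℕ.≤ u → Exponents.Good a b (suc D) b<a (λ q → ‖ q · θ ‖) u ⊎
                            Exponents.Good a b (suc D) b<a (λ q → ‖ q · η ‖) u
    eventuallyGood {θ} {η} {γ} T c U D a≤bγ bdd T≤U c≤D {u} U<u =
      Sum.map (achieved θ) (achieved η)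
        (⊓-elim (λ x → t ^ℝ γ * x ≤ c) (ψ θ t) (ψ η t) (bdd t T≤t))
      where
      1≤u^b : 1 ℕ.≤ u ℕ.^ b
      1≤u^b = ℕ.m^n>0 u {{ℕ.>-nonZero (ℕ.≤-<-trans z≤n U<u)}} b
      t = natural (u ℕ.^ b) 1≤u^b
      T≤t : T ≤ proj₁ t
      T≤t = ≤-trans T≤U (fromℕ-mono (ℕ.≤-trans (ℕ.<⇒≤ U<u) (n≤n^k u b)))
      achieved : ∀ ρ → t ^ℝ γ * ψ ρ t ≤ c → Exponents.Good a b (suc D) b<a (λ q → ‖ q · ρ ‖) u
      achieved ρ p = proj₁ m , proj₁ (proj₁ (proj₂ m)) , fromℕ-reflect {n = u ℕ.^ b} (proj₂ (proj₁ (proj₂ m))) ,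
        ≤-trans (≤-reflexive (·≈fromℕ* (u ℕ.^ a) _)) (≤-trans
          (*-mono-r (ψ-nonneg ρ t) (u^a≤[u^b]^γ {u} {a} {b} {γ} 1≤u^b 1≤b a≤bγ))
          (≤-trans p (≤-trans c≤D (fromℕ-mono (ℕ.n≤1+n D)))))
        where m = minimizer (λ q → ‖ q · ρ ‖) (proj₁ t) (proj₂ t)

    good : ∀ {θ η γ} → fromℕ a ≤ b · γ → ϖ-Set θ η γ → ∃[ D ] ∃[ U ]
           (∀ {u} → U ℕ.≤ u → Exponents.Good a b (suc D) b<a (λ q → ‖ q · θ ‖) u ⊎
                              Exponents.Good a b (suc D) b<a (λ q → ‖ q · η ‖) u)
    good {θ} {η} {γ} a≤bγ γ∈ =
      let (T , _) , c , bdd = limsup<⊤ (λ t → t ^ℝ γ * ψ₂ θ η t) γ∈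
          U , T≤U = archimedean T
          D , c≤D = archimedean c
      in D , suc U , eventuallyGood T c U D a≤bγ bdd T≤U c≤D

    -- Take `δ = a² / b²` and `t = v^(b²)`: then `t ^ℝ δ ≤ v^(a²)`, so `t ^ℝ δ * ψ η t` is at most
    -- `K` for arbitrarily large `t`.
    exponent : ∀ {η} K →
      (∀ T → ∃[ v ] (T ℕ.≤ v × ∃[ s ] (1 ℕ.≤ s × s ℕ.≤ v ℕ.^ (b ℕ.* b) ×
        (v ℕ.^ (a ℕ.* a)) · ‖ s · η ‖ ≤ fromℕ K))) →
      ∃[ δ ] (ω-Set η δ × (b ℕ.* b) · δ ≈ fromℕ (a ℕ.* a))
    exponent {η} K often with ·-divide (b ℕ.* b) {{ℕ.m*n≢0 b b}} (fromℕ (a ℕ.* a))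
    ... | δ , bbδ≈aa = δ , ≤[]⇒<⊤ (liminf≤ (λ t → t ^ℝ δ * ψ η t) (fromℕ K) witness) , bbδ≈aa
      where
      witness : ∀ T → ∃[ t ] (proj₁ T ≤ proj₁ t × t ^ℝ δ * ψ η t ≤ fromℕ K)
      witness (T , _) with archimedean T
      ... | n , T≤n with often (suc n)
      ...   | v , n<v , s , 1≤s , s≤ , p = t , T≤t , ≤-trans
        (*-mono-r (ψ-nonneg η t) ([u^b]^γ≤u^a {v} {a ℕ.* a} {b ℕ.* b} {δ} 1≤v^bb 1≤v (≤-reflexive bbδ≈aa)))
        (≤-trans (≤-reflexive (sym (·≈fromℕ* (v ℕ.^ (a ℕ.* a)) _)))
          (≤-trans (·-mono (v ℕ.^ (a ℕ.* a)) ψ≤) p))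
        where
        1≤v : 1 ℕ.≤ v
        1≤v = ℕ.≤-trans (s≤s z≤n) n<v
        1≤v^bb : 1 ℕ.≤ v ℕ.^ (b ℕ.* b)
        1≤v^bb = ℕ.m^n>0 v {{ℕ.>-nonZero 1≤v}} (b ℕ.* b)
        t = natural (v ℕ.^ (b ℕ.* b)) 1≤v^bb
        T≤t : T ≤ proj₁ t
        T≤t = ≤-trans T≤n (fromℕ-mono (ℕ.≤-trans (ℕ.<⇒≤ n<v) (n≤n^k v (b ℕ.* b) {{ℕ.m*n≢0 b b}})))
        ψ≤ : ψ η t ≤ ‖ s · η ‖
        ψ≤ = proj₂ (proj₂ (minimizer (λ q → ‖ q · η ‖) (proj₁ t) (proj₂ t))) s 1≤s (fromℕ-mono s≤)

    transfer : ∀ {θ η γ} → Irrational θ → Irrational η → fromℕ a ≤ b · γ → ϖ-Set θ η γ →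
               (∃[ δ ] (ω-Set θ δ × (b ℕ.* b) · δ ≈ fromℕ (a ℕ.* a))) ×
               (∃[ δ ] (ω-Set η δ × (b ℕ.* b) · δ ≈ fromℕ (a ℕ.* a)))
    transfer {θ} {η} {γ} θ-irr η-irr a≤bγ γ∈ =
      let D , U , small = good {θ} {η} {γ} a≤bγ γ∈
          open Exponents a b (suc D) b<a
      in exponent {θ} (K ℕ.^ a ℕ.* suc D)
           -- The conclusion of `squareExponent` concerns its second function; exchanging the roles
           -- of `θ` and `η` gives the bound for `θ`.
           (squareExponent (staircase η-irr) (staircase θ-irr) U λ p → swap (small p)) ,
         exponent {η} (K ℕ.^ a ℕ.* suc D)
           (squareExponent (staircase θ-irr) (staircase η-irr) U small)

  -- From rational exponents to the squared supremum.

  Attains : Pred ℝ 0ℓ → ℕ → ℕ → Set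
  Attains S a b = ∃[ γ ] (S γ × fromℕ a ≤ b · γ)

  ∈⇒≤supℝ : ∀ S {γ} → S γ → [ γ ] ≤± supℝ S
  ∈⇒≤supℝ S {γ} γ∈ = proj₁ (proj₂ (supremum λ x → ∃[ γ ] (S γ × x ≡ [ γ ]))) [ γ ] (γ , γ∈ , ≡.refl)

  exceeds : ∀ S y → ¬ (supℝ S ≤± [ y ]) → ∃[ γ ] (S γ × ¬ (γ ≤ y))
  exceeds S y sup≰ = ¬¬-elim λ none → sup≰ (proj₂ (proj₂ (supremum _)) [ y ]
    λ { _ (γ , γ∈ , ≡.refl) → ≤±.[ ¬¬-elim (λ γ≰y → none (γ , γ∈ , γ≰y)) ] })

  attains : ∀ S a b .{{_ : NonZero b}} → (∀ {y} → b · y ≈ fromℕ a → ¬ (supℝ S ≤± [ y ])) → Attains S a b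
  attains S a b sup≰ with ·-divide b (fromℕ a)
  ... | y , by≈a with exceeds S y (sup≰ by≈a)
  ...   | γ , γ∈ , γ≰y = γ , γ∈ , ≤-trans (≤-reflexive (sym by≈a)) (·-mono b (≰⇒≥ γ≰y))

  -- Take `a` to be the ceiling of `n x` minus 2, which keeps `a / n` below `x` by at least `1 / n`.
  -- Choosing `n₀` with `n₀ (x - 1) > 3` leaves room for `a > n`.
  rationalsBelow : ∀ {x} → ¬ (x ≤ 1#) → ∃[ n₀ ] (∀ {n} → n₀ ℕ.≤ n →
                   ∃[ a ] (n ℕ.< a × fromℕ (suc a) ≤ n · x × n · x ≤ fromℕ (2 ℕ.+ a)))
  rationalsBelow {x} x≰1 with archimedean-· {x + - 1#} (λ p → x≰1 (resp (x-y+y x 1#) (+-identityˡ 1#) (+-monoˡ 1# p))) 3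
  ... | n₀ , large = n₀ , λ {n} n₀≤n → build n (above n₀≤n) (leastWitness (λ m → n · x ≤ fromℕ m))
    where
    above : ∀ {n} → n₀ ℕ.≤ n → fromℕ (3 ℕ.+ n) ≤ n · x
    above {n} n₀≤n = resp (sym (Mult.×-homo-+ 1# 3 n))
      (trans (sym (Mult.×-distrib-+ (x + - 1#) 1# n)) (Mult.×-congʳ n (x-y+y x 1#)))
      (+-mono (≤-trans (≰⇒≥ large) (·-monoˡ n₀≤n 0≤x-1)) ≤-refl)
      where
      0≤x-1 : 0# ≤ x + - 1#
      0≤x-1 = 0≤y-x (≰⇒≥ x≰1)
    build : ∀ n → fromℕ (3 ℕ.+ n) ≤ n · x →
      (∀ m → ¬ (n · x ≤ fromℕ m)) ⊎ ∃[ m ] (n · x ≤ fromℕ m × (∀ {i} → i ℕ.< m → ¬ (n · x ≤ fromℕ i))) →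
      ∃[ a ] (n ℕ.< a × fromℕ (suc a) ≤ n · x × n · x ≤ fromℕ (2 ℕ.+ a))
    build n 3+n≤ (inj₁ none) = contradiction (proj₂ (archimedean (n · x))) (none (proj₁ (archimedean (n · x))))
    build n 3+n≤ (inj₂ (m , ≤m , least)) with fromℕ-reflect {3 ℕ.+ n} {m} (≤-trans 3+n≤ ≤m)
    ... | s≤s (s≤s {n = a} n<a) = a , n<a , ≰⇒≥ (least (ℕ.n<1+n (suc a))) , ≤m

  -- The limit `a / n → x` made explicit. From `n² x² ≤ (a + 2)² ≤ a² + 8 (a + 1) ≤ n² w + 8 n
  -- x` one gets `n (x² - w) ≤ 8 x`, which bounds `n` if `x² > w`.
  square≤ : ∀ {x w} n₀ →
    (∀ {n} → n₀ ℕ.≤ n → ∃[ a ] (fromℕ (suc a) ≤ n · x × n · x ≤ fromℕ (2 ℕ.+ a) ×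
      fromℕ (a ℕ.* a) ≤ (n ℕ.* n) · w)) →
    x * x ≤ w
  square≤ {x} {w} n₀ approx = ¬¬-elim λ xx≰w → refute λ p → xx≰w (resp (x-y+y (x * x) w) (+-identityˡ w) (+-monoˡ w p))
    where
    e = x * x + - w
    refute : ¬ ¬ (e ≤ 0#)
    refute e≰0 with archimedean (8 · x)
    ... | d , 8x≤d with archimedean-· e≰0 d
    ...   | m , large = large (≤-trans
      (·-monoˡ {m} {n} (ℕ.m≤n⇒m≤1+n (ℕ.m≤n+m m n₀)) (≰⇒≥ e≰0))
      (≤-trans (·-cancelˡ-≤ n n·n·e≤n·8x) 8x≤d))
      where
      -- Beyond `n₀` so that `approx` applies, beyond `m` so that `n · e` exceeds `8 · x`, and
      -- positive so that one factor `n` cancels.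
      n = suc (n₀ ℕ.+ m)
      a = proj₁ (approx {n} (ℕ.m≤n⇒m≤1+n (ℕ.m≤m+n n₀ m)))
      bounds = proj₂ (approx {n} (ℕ.m≤n⇒m≤1+n (ℕ.m≤m+n n₀ m)))
      [2+a]²≤ : (2 ℕ.+ a) ℕ.* (2 ℕ.+ a) ℕ.≤ a ℕ.* a ℕ.+ 8 ℕ.* suc a
      [2+a]²≤ = ≡.subst ((2 ℕ.+ a) ℕ.* (2 ℕ.+ a) ℕ.≤_)
        (solve 1 (λ a → (con 2 :+ a) :* (con 2 :+ a) :+ con 4 :* (con 1 :+ a) := a :* a :+ con 8 :* (con 1 :+ a)) ≡.refl a)
        (ℕ.m≤m+n _ (4 ℕ.* suc a))
        where open +-*-Solver
      0≤nx : 0# ≤ n · x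
      0≤nx = ≤-trans (0≤fromℕ (suc a)) (proj₁ bounds)
      n²x²≤ : (n ℕ.* n) · (x * x) ≤ (n ℕ.* n) · w + 8 · (n · x)
      n²x²≤ = ≤-trans (≤-reflexive (sym (*-·-· n n x x))) (≤-trans
        (≤-trans (*-mono-r 0≤nx (proj₁ (proj₂ bounds))) (*-mono-l (0≤fromℕ (2 ℕ.+ a)) (proj₁ (proj₂ bounds))))
        (≤-trans (≤-reflexive (sym (Mult.×1-homo-* (2 ℕ.+ a) (2 ℕ.+ a)))) (≤-trans (fromℕ-mono [2+a]²≤)
          (≤-trans (≤-reflexive (trans (Mult.×-homo-+ 1# (a ℕ.* a) (8 ℕ.* suc a)) (+-congˡ (sym (·-fromℕ 8 (suc a))))))
            (+-mono (proj₂ (proj₂ bounds)) (·-mono 8 (proj₁ bounds)))))))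
      n·n·e≤n·8x : n · (n · e) ≤ n · (8 · x)
      n·n·e≤n·8x = resp (sym (Mult.×-assocˡ e n n))
        (trans (Mult.×-assocˡ x 8 n) (trans (Mult.×-congˡ (ℕ.*-comm 8 n)) (sym (Mult.×-assocˡ x n 8))))
        (+-cancel ((n ℕ.* n) · w) (resp
          (trans (Mult.×-congʳ (n ℕ.* n) (sym (x-y+y (x * x) w))) (Mult.×-distrib-+ e w (n ℕ.* n)))
          (+-comm _ _) n²x²≤))

  -- It suffices to place the squares of the rationals strictly between 1 and `s` below `w`. The
  -- fraction a / b is given by the equation for `y`, and its square by the one for `δ`.
  ²≤-fromRationals : ∀ s w → [ 1# ] <± s →
    (∀ {a b} → 1 ℕ.≤ b → b ℕ.< a → (∀ {y} → b · y ≈ fromℕ a → ¬ (s ≤± [ y ])) →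
      ∃[ δ ] ([ δ ] ≤± w × (b ℕ.* b) · δ ≈ fromℕ (a ℕ.* a))) →
    s ² ≤± w
  ²≤-fromRationals ⊥±    w     (1≤s , _) H = contradiction 1≤s λ { Supremum≤.[ () ] }
  ²≤-fromRationals s     ⊤±    1<s H = (s ²) ≤±.≤⊤±
  ²≤-fromRationals ⊤±    ⊥±    1<s H with H {2} {1} (s≤s z≤n) (s≤s (s≤s z≤n)) (λ _ ())
  ... | δ , Supremum≤.[ () ] , _
  ²≤-fromRationals ⊤±    [ w ] 1<s H with archimedean w
  -- An infinite `s` exceeds the integer `2 + n`, whose square is larger than `n ≥ w`.
  ... | n , w≤n with H {2 ℕ.+ n} {1} (s≤s z≤n) (s≤s (s≤s z≤n)) (λ _ ())
  ...   | δ , δ≤w , δ≈ = contradiction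
    (fromℕ-reflect {(2 ℕ.+ n) ℕ.* (2 ℕ.+ n)} {n} (≤-trans (≤-reflexive (trans (sym δ≈) (+-identityʳ δ)))
      (≤-trans (≤±.[≤]-injective δ≤w) w≤n)))
    (ℕ.<⇒≱ (ℕ.≤-trans (ℕ.n≤1+n _) (ℕ.m≤m*n (2 ℕ.+ n) (2 ℕ.+ n))))
  ²≤-fromRationals [ x ] w     (1≤x , 1≉x) H = finite w approx
    where
    x≰1 : ¬ (x ≤ 1#)
    x≰1 p = 1≉x ≈±.[ antisym (≤±.[≤]-injective 1≤x) p ]
    n₀ : ℕ
    n₀ = proj₁ (rationalsBelow x≰1)
    -- Starting at `suc n₀` makes the denominator `n` positive.
    approx : ∀ {n} → suc n₀ ℕ.≤ n → ∃[ a ] (fromℕ (suc a) ≤ n · x × n · x ≤ fromℕ (2 ℕ.+ a) ×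
      ∃[ δ ] ([ δ ] ≤± w × (n ℕ.* n) · δ ≈ fromℕ (a ℕ.* a)))
    approx {n} n₀<n =
      let a , n<a , 1+a≤nx , nx≤2+a = proj₂ (rationalsBelow x≰1) (ℕ.<⇒≤ n₀<n)
      in a , 1+a≤nx , nx≤2+a , H (ℕ.≤-trans (s≤s z≤n) n₀<n) n<a λ ny≈a x≤y →
        ℕ.1+n≰n {a} (fromℕ-reflect {suc a} {a} (≤-trans 1+a≤nx (≤-trans
          (·-mono n (≤±.[≤]-injective x≤y)) (≤-reflexive ny≈a))))
    finite : ∀ w → (∀ {n} → suc n₀ ℕ.≤ n → ∃[ a ] (fromℕ (suc a) ≤ n · x × n · x ≤ fromℕ (2 ℕ.+ a) ×
      ∃[ δ ] ([ δ ] ≤± w × (n ℕ.* n) · δ ≈ fromℕ (a ℕ.* a)))) → [ x * x ] ≤± w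
    finite ⊥± approx′ with proj₂ (proj₂ (proj₂ (approx′ ℕ.≤-refl)))
    ... | δ , Supremum≤.[ () ] , _
    finite ⊤± approx′ = [ x * x ] ≤±.≤⊤±
    finite [ w ] approx′ = ≤±.[ square≤ (suc n₀) (λ {n} n₀<n →
      let a , l , u , δ , δ≤w , δ≈ = approx′ n₀<n
      in a , l , u , ≤-trans (≤-reflexive (sym δ≈)) (·-mono (n ℕ.* n) (≤±.[≤]-injective δ≤w))) ]

  sup²≤sup : ∀ S S′ →
    (∀ {a b} → 1 ℕ.≤ b → b ℕ.< a → Attains S a b → ∃[ δ ] (S′ δ × (b ℕ.* b) · δ ≈ fromℕ (a ℕ.* a))) →
    [ 1# ] <± supℝ S → supℝ S ² ≤± supℝ S′
  sup²≤sup S S′ H 1<sup = ²≤-fromRationals (supℝ S) (supℝ S′) 1<sup λ {a} {b} 1≤b b<a sup≰ →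
    let δ , δ∈ , δ≈ = H 1≤b b<a (attains S a b {{ℕ.>-nonZero 1≤b}} sup≰)
    in δ , ∈⇒≤supℝ S′ δ∈ , δ≈

  ⊓±-greatest : ∀ {x} y z → x ≤± y → x ≤± z → x ≤± (y ⊓± z)
  ⊓±-greatest y z x≤y x≤z with TotalOrder.total totalOrder± y z
  ... | inj₁ _ = x≤y
  ... | inj₂ _ = x≤z

  ϖ²≤ω⊓ω : ∀ {θ η} → Irrational θ → Irrational η → [ 1# ] <± ϖ θ η → ϖ θ η ² ≤± (ω θ ⊓± ω η)
  ϖ²≤ω⊓ω {θ} {η} θ-irr η-irr 1<ϖ = ⊓±-greatest (ω θ) (ω η)
    (sup²≤sup (ϖ-Set θ η) (ω-Set θ) (λ 1≤b b<a (_ , γ∈ , a≤bγ) → proj₁ (both 1≤b b<a a≤bγ γ∈)) 1<ϖ)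
    (sup²≤sup (ϖ-Set θ η) (ω-Set η) (λ 1≤b b<a (_ , γ∈ , a≤bγ) → proj₂ (both 1≤b b<a a≤bγ γ∈)) 1<ϖ)
    where
    both : ∀ {a b γ} → 1 ℕ.≤ b → b ℕ.< a → fromℕ a ≤ b · γ → ϖ-Set θ η γ →
           (∃[ δ ] (ω-Set θ δ × (b ℕ.* b) · δ ≈ fromℕ (a ℕ.* a))) ×
           (∃[ δ ] (ω-Set η δ × (b ℕ.* b) · δ ≈ fromℕ (a ℕ.* a)))
    both {a} {b} {γ} 1≤b b<a = Rational.transfer {a} {b} {{ℕ.>-nonZero 1≤b}} b<a {θ} {η} {γ} θ-irr η-irr

theorem2 : (em : ExcludedMiddle 0ℓ) (ℝ-field : CompleteOrderedField) →
    let open Diophantine em ℝ-field in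
    (θ η : ℝ) → Irrational θ → Irrational η →
    [ 1# ] <± ϖ θ η →
    (ϖ θ η) ² ≤± (ω θ ⊓± ω η)
theorem2 em ℝ-field θ η = Proof.ϖ²≤ω⊓ω em ℝ-field {θ} {η}
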